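{- For any nonnegative integers $f$ and $\sigma$, there are $n$-vertex unweighted (directed or undirected) graphs $G=(V,E)$, vertex subsets $S\subseteq V$ with $|S|=\sigma$, and RPTSes $\pi$ on $G$ that are consistent, stable, and (in the undirected case) symmetric, such that the $f$-FT $S\times V$ preserver formed by overlaying all replacement paths $\pi(s,v\mid F)$ with $s\in S$, $v\in V$, $F\subseteq E$, $|F|\le f$, has $\Omega\left(n^{2-1/2^f}\sigma^{1/2^f}\right)$ edges.
   Context: A replacement path tiebreaking scheme (RPTS) on $G=(V,E)$ is a function $\pi(s,t\mid F)$, for vertices $s,t$ and $F\subseteq E$, such that for each fixed $F$, $\pi(s,t\mid F)$ is one particular shortest $s\leadsto t$ path in $G\setminus F$ (or $\emptyset$ if none exists). $\pi$ is consistent if for every $F$ and all vertices $s,t,u,v$, whenever $u$ precedes $v$ on $\pi(s,t\mid F)$, $\pi(u,v\mid F)$ is a contiguous subpath of $\pi(s,t\mid F)$. $\pi$ is stable if for all $s,t,F$ and every edge $f'\notin\pi(s,t\mid F)$, $\pi(s,t\mid F)=\pi(s,t\mid F\cup\{f'\})$. $\pi$ is symmetric if $\pi(s,t\mid F)=\pi(t,s\mid F)$ for all $s,t,F$. An $f$-FT $S\times V$ preserver of $G$ is a subgraph $H$ with $\mathrm{dist}_{H\setminus F}(s,t)=\mathrm{dist}_{G\setminus F}(s,t)$ for all $s\in S$, $t\in V$, $F\subseteq E$ with $|F|\le f$. -}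

module Defs where

open import Data.Bool using (Bool; true; false; _∧_; _∨_; if_then_else_)
open import Data.Nat using (ℕ; zero; suc; _+_; _*_; _∸_; _^_; _≤_; _<ᵇ_)
open import Data.Fin using (Fin; toℕ; _≟_)
open import Data.List using (List; []; _∷_; _++_; length; last; map; reverse; allFin)
open import Data.Nat.ListAction using (sum)
open import Data.Maybe using (Maybe; just; nothing)
import Data.Maybe as Maybe
open import Data.Product using (Σ; _×_; _,_; ∃)
open import Data.Sum using (_⊎_)
open import Data.Unit using (⊤)
open import Data.Empty using (⊥)
open import Relation.Nullary using (¬_)
open import Relation.Nullary.Decidable using (⌊_⌋)
open import Relation.Binary.PropositionalEquality using (_≡_)
open import Data.List.Membership.Propositional using (_∈_)

BRel : ℕ → Set
BRel n = Fin n → Fin n → Bool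

data Kind : Set where
  directed undirected : Kind

record Graph (k : Kind) (n : ℕ) : Set where
  field
    adj      : BRel n
    loopless : ∀ u → adj u u ≡ false
    symm     : k ≡ undirected → ∀ u v → adj u v ≡ adj v u
open Graph public

-- canonical orientation of an edge: every ordered pair (directed),
-- pairs with u < v (undirected; edge {u,v} is represented once).
canon : Kind → {n : ℕ} → Fin n → Fin n → Bool
canon directed   u v = true
canon undirected u v = toℕ u <ᵇ toℕ v

ValidF : ∀ {k n} → Graph k n → BRel n → Set
ValidF {k} G F = (∀ u v → F u v ≡ true → adj G u v ≡ true)
               × (k ≡ undirected → ∀ u v → F u v ≡ F v u)

size : Kind → {n : ℕ} → BRel n → ℕ
size k {n} F = sum (map (λ u → sum (map (λ v → if F u v ∧ canon k u v then 1 else 0) (allFin n))) (allFin n))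

addE : Kind → {n : ℕ} → BRel n → Fin n → Fin n → BRel n
addE directed   F u v x y = F x y ∨ (⌊ x ≟ u ⌋ ∧ ⌊ y ≟ v ⌋)
addE undirected F u v x y = F x y ∨ (⌊ x ≟ u ⌋ ∧ ⌊ y ≟ v ⌋) ∨ (⌊ x ≟ v ⌋ ∧ ⌊ y ≟ u ⌋)

Steps : ∀ {k n} → Graph k n → BRel n → List (Fin n) → Set
Steps G F []            = ⊤
Steps G F (u ∷ [])      = ⊤
Steps G F (u ∷ v ∷ p)   = adj G u v ≡ true × F u v ≡ false × Steps G F (v ∷ p)

IsPath : ∀ {k n} → Graph k n → BRel n → Fin n → Fin n → List (Fin n) → Set
IsPath G F s t p = (Σ (List _) λ r → p ≡ s ∷ r) × last p ≡ just t × Steps G F p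

IsShortest : ∀ {k n} → Graph k n → BRel n → Fin n → Fin n → List (Fin n) → Set
IsShortest G F s t p = IsPath G F s t p × (∀ q → IsPath G F s t q → length p ≤ length q)

CorrectValue : ∀ {k n} → Graph k n → BRel n → Fin n → Fin n → Maybe (List (Fin n)) → Set
CorrectValue G F s t (just p) = IsShortest G F s t p
CorrectValue G F s t nothing  = ∀ q → ¬ IsPath G F s t q

Scheme : ℕ → Set
Scheme n = Fin n → Fin n → BRel n → Maybe (List (Fin n))

IsRPTS : ∀ {k n} → Graph k n → Scheme n → Set
IsRPTS G π = ∀ F → ValidF G F → ∀ s t → CorrectValue G F s t (π s t F)

Consistent : ∀ {k n} → Graph k n → Scheme n → Set
Consistent G π = ∀ F → ValidF G F → ∀ s t a u b v c →
  π s t F ≡ just (a ++ u ∷ b ++ v ∷ c) →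
  Σ (List _) λ q → π u v F ≡ just q ×
    (Σ (List _) λ x → Σ (List _) λ y → a ++ u ∷ b ++ v ∷ c ≡ x ++ q ++ y)

Consec : ∀ {n} → Fin n → Fin n → List (Fin n) → Set
Consec u v p = Σ (List _) λ x → Σ (List _) λ y → p ≡ x ++ u ∷ v ∷ y

OnPath : Kind → ∀ {n} → Fin n → Fin n → List (Fin n) → Set
OnPath directed   u v p = Consec u v p
OnPath undirected u v p = Consec u v p ⊎ Consec v u p

OnM : Kind → ∀ {n} → Fin n → Fin n → Maybe (List (Fin n)) → Set
OnM k u v (just p) = OnPath k u v p
OnM k u v nothing  = ⊥

Stable : ∀ {k n} → Graph k n → Scheme n → Set
Stable {k} G π = ∀ F → ValidF G F → ∀ s t u v → adj G u v ≡ true →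
  ¬ OnM k u v (π s t F) → π s t F ≡ π s t (addE k F u v)

Symmetric : ∀ {k n} → Graph k n → Scheme n → Set
Symmetric G π = ∀ F → ValidF G F → ∀ s t → π t s F ≡ Maybe.map reverse (π s t F)

InOverlay : ∀ {k n} → Graph k n → Scheme n → ℕ → List (Fin n) → Fin n × Fin n → Set
InOverlay {k} G π f S (u , v) =
  Σ (Fin _) λ s → s ∈ S × Σ (Fin _) λ t → Σ (BRel _) λ F →
    ValidF G F × size k F ≤ f × OnM k u v (π s t F)

module Submission where

-- A best path for a generic edge weighting is unique, and choosing it gives a consistent, stable
-- and symmetric scheme, so only the weights matter. They are chosen so that among equally long
-- paths along which the vertex numbers increase, the lexicographically largest one wins.
--
-- Put trees under the sources, all of whose leaves have the same depth, and join every leaf to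
-- every vertex of a large set X. Without a distance gap between leaves it is the weights alone
-- that decide through which leaf z a vertex x ∈ X is reached: the rightmost one still connected
-- to the root. So z is forced by cutting, at each left turn on the way to z, the edge to the
-- right. Let the tree for f + 1 be a path of length m carrying m copies of the tree for f, which
-- has about m nodes. That adds one left turn and squares the number of nodes, so with b ^ 2 ^ f
-- nodes there are b ^ (2 ^ f - 1) leaves, each forced by at most f faults.

open import Defs
open import Data.Nat hiding (_≟_)
open import Data.Fin using (Fin; toℕ; fromℕ<; _≟_)
open import Data.List
  using (List; []; _∷_; _++_; _∷ʳ_; [_]; length; last; head; reverse; lookup; map; filter; upTo; allFin;
         cartesianProduct; cartesianProductWith)
open import Data.Product using (Σ; _×_; _,_; ∃; proj₁; proj₂)
open import Data.Bool using (Bool; true; false; _∨_; _∧_; T; if_then_else_)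
open import Relation.Binary.PropositionalEquality hiding ([_])
open import Data.List.Relation.Unary.All using (All; []; _∷_)
open import Data.List.Relation.Unary.Unique.Propositional using (Unique)

open import Algebra.Properties.CommutativeSemigroup using (interchange)
import Data.Bool as Bool
open import Data.Bool.Properties using (∨-comm)
open import Data.Empty using (⊥-elim)
import Data.Fin as Fin
open import Data.Fin.Properties using (toℕ<n; toℕ-injective; toℕ-fromℕ<; pigeonhole)
import Data.List.Membership.DecPropositional as DecMembership
open import Data.List.Membership.Propositional using (_∈_)
open import Data.List.Membership.Propositional.Properties
  using (∈-∃++; ∈-lookup; ∈-++⁻; ∈-map⁺; ∈-map⁻; ∈-filter⁺; ∈-upTo⁺; ∈-upTo⁻; ∈-allFin;
         ∈-cartesianProduct⁻; ∈-cartesianProductWith⁺)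
open import Data.List.Properties
  using (length-++; length-map; length-upTo; length-reverse; ++-assoc; unfold-reverse; map-cong)
open import Data.List.Relation.Binary.Disjoint.Propositional using (Disjoint)
import Data.List.Relation.Unary.All as All
import Data.List.Relation.Unary.All.Properties as All
import Data.List.Relation.Unary.AllPairs as AllPairs
open import Data.List.Relation.Unary.AllPairs using ([]; _∷_)
open import Data.List.Relation.Unary.Any using (here; there)
open import Data.List.Relation.Unary.Linked using (Linked; []; [-]; _∷_)
open import Data.List.Relation.Unary.Linked.Properties using (Linked⇒AllPairs)
import Data.List.Relation.Unary.Unique.DecPropositional as Unique?
import Data.List.Relation.Unary.Unique.Propositional.Properties as Unique
open import Data.Maybe using (Maybe; just; nothing)
import Data.Maybe.Properties as Maybe
import Data.Nat as ℕ
open import Data.Nat.DivMod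
  using (_/_; _%_; m≡m%n+[m/n]*n; m%n<n; m<n*o⇒m/o<n; [m+kn]%n≡m%n; m<n⇒m%n≡m)
open import Data.Nat.ListAction using (sum)
open import Data.Nat.Properties hiding (_≟_)
open import Data.List.Extrema ≤-totalOrder using (argmin; argmin-all; f[argmin]≤f[⊤]; f[argmin]≤f[xs])
open import Data.Nat.Solver using (module +-*-Solver)
import Data.Product.Properties as Product
open import Data.Sum using (_⊎_; inj₁; inj₂)
open import Data.Unit using (tt)
open import Function using (_∘_; case_of_)
open import Relation.Nullary using (¬_; Dec; yes; no)
open import Relation.Nullary.Decidable using (_×-dec_; map′; ⌊_⌋)

open +-*-Solver using (solve; con; _:+_; _:*_; _:=_)
open DecMembership (Product.≡-dec ℕ._≟_ ℕ._≟_) using (_∈?_)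

-- Weights and unique cheapest walks

-- One weighting serves both kinds of graphs, so a weight sees only the unordered pair of its ends.
-- The base of the weights exceeds the number of edges of any simple walk, so a total weight
-- determines which edges occur. Uniqueness then yields the properties of the scheme: parts of a
-- cheapest walk are cheapest, a cheapest walk survives a fault it does not use, and reversal keeps
-- the cost. Preorder numbers make every edge of the forest increasing and every right child larger
-- than its left sibling, so "lexicographically largest" means "rightmost". In an undirected graph a
-- walk might also go down. Levels exclude this: roots have level 0, sinks level `suc D`, and an
-- edge raises the level by at most one, so a walk with `suc D` edges climbs in every step, and the
-- directed analysis applies unchanged. The sinks make up at least half of the `n` vertices; all
-- numbers beyond the forest are sinks, so every large enough `n` is reached without padding.

module _ (B : ℕ) where

  ΣB^ : List ℕ → ℕ
  ΣB^ []       = 0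
  ΣB^ (x ∷ xs) = B ^ x + ΣB^ xs

  zeros : List ℕ → ℕ
  zeros []           = 0
  zeros (zero ∷ xs)  = suc (zeros xs)
  zeros (suc _ ∷ xs) = zeros xs

  preds : List ℕ → List ℕ
  preds []           = []
  preds (zero ∷ xs)  = preds xs
  preds (suc x ∷ xs) = x ∷ preds xs

  zeros≤length : ∀ xs → zeros xs ≤ length xs
  zeros≤length []           = z≤n
  zeros≤length (zero ∷ xs)  = s≤s (zeros≤length xs)
  zeros≤length (suc _ ∷ xs) = m≤n⇒m≤1+n (zeros≤length xs)

  preds≤length : ∀ xs → length (preds xs) ≤ length xs
  preds≤length []           = z≤n
  preds≤length (zero ∷ xs)  = m≤n⇒m≤1+n (preds≤length xs)
  preds≤length (suc _ ∷ xs) = s≤s (preds≤length xs)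

  zero∈⇒zeros>0 : ∀ {xs} → 0 ∈ xs → 0 < zeros xs
  zero∈⇒zeros>0 (here refl)              = z<s
  zero∈⇒zeros>0 {zero ∷ _} (there 0∈xs)  = z<s
  zero∈⇒zeros>0 {suc _ ∷ _} (there 0∈xs) = zero∈⇒zeros>0 0∈xs

  zeros>0⇒zero∈ : ∀ xs → 0 < zeros xs → 0 ∈ xs
  zeros>0⇒zero∈ (zero ∷ _)   _ = here refl
  zeros>0⇒zero∈ (suc _ ∷ xs) p = there (zeros>0⇒zero∈ xs p)

  ∈-preds⁺ : ∀ {x xs} → suc x ∈ xs → x ∈ preds xs
  ∈-preds⁺ (here refl)             = here refl
  ∈-preds⁺ {xs = zero ∷ _} (there x∈)  = ∈-preds⁺ x∈
  ∈-preds⁺ {xs = suc _ ∷ _} (there x∈) = there (∈-preds⁺ x∈)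

  ∈-preds⁻ : ∀ {x} xs → x ∈ preds xs → suc x ∈ xs
  ∈-preds⁻ (zero ∷ xs)  x∈         = there (∈-preds⁻ xs x∈)
  ∈-preds⁻ (suc _ ∷ xs) (here refl) = here refl
  ∈-preds⁻ (suc _ ∷ xs) (there x∈)  = there (∈-preds⁻ xs x∈)

  -- Division by `B` with remainder: the exponents 0 contribute the units, all others are lowered by
  -- one in the quotient. This lets an induction on the exponent peel off one digit at a time.
  ΣB^-preds : ∀ xs → ΣB^ xs ≡ zeros xs + ΣB^ (preds xs) * B
  ΣB^-preds []           = refl
  ΣB^-preds (zero ∷ xs)  = cong suc (ΣB^-preds xs)
  ΣB^-preds (suc x ∷ xs) = begin
    B * B ^ x + ΣB^ xs                              ≡⟨ cong₂ _+_ (*-comm B (B ^ x)) (ΣB^-preds xs) ⟩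
    B ^ x * B + (zeros xs + ΣB^ (preds xs) * B)     ≡⟨ sym (+-assoc (B ^ x * B) _ _) ⟩
    (B ^ x * B + zeros xs) + ΣB^ (preds xs) * B     ≡⟨ cong (_+ ΣB^ (preds xs) * B) (+-comm (B ^ x * B) _) ⟩
    (zeros xs + B ^ x * B) + ΣB^ (preds xs) * B     ≡⟨ +-assoc (zeros xs) _ _ ⟩
    zeros xs + (B ^ x * B + ΣB^ (preds xs) * B)     ≡⟨ cong (zeros xs +_) (sym (*-distribʳ-+ B (B ^ x) _)) ⟩
    zeros xs + (B ^ x + ΣB^ (preds xs)) * B         ∎
    where open ≡-Reasoning

  -- Exponents are read off as base-B digits: fewer than B summands produce no carries.
  ΣB^-members : ∀ {x} xs ys → length xs < B → length ys < B → ΣB^ xs ≡ ΣB^ ys → x ∈ xs → x ∈ ys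
  ΣB^-members {x} xs ys |xs|<B |ys|<B eq x∈ = go x x∈
    where
    instance
      B≢0 : NonZero B
      B≢0 = >-nonZero (≤-<-trans z≤n |xs|<B)
    zeros% : ∀ zs → length zs < B → ΣB^ zs % B ≡ zeros zs
    zeros% zs |zs|<B = trans (cong (_% B) (ΣB^-preds zs))
      (trans ([m+kn]%n≡m%n (zeros zs) (ΣB^ (preds zs)) B) (m<n⇒m%n≡m (≤-<-trans (zeros≤length zs) |zs|<B)))
    zeros≡ : zeros xs ≡ zeros ys
    zeros≡ = trans (sym (zeros% xs |xs|<B)) (trans (cong (_% B) eq) (zeros% ys |ys|<B))
    preds≡ : ΣB^ (preds xs) ≡ ΣB^ (preds ys)
    preds≡ = *-cancelʳ-≡ _ _ B (+-cancelˡ-≡ (zeros xs) _ _ (trans (sym (ΣB^-preds xs))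
      (trans eq (trans (ΣB^-preds ys) (cong (_+ ΣB^ (preds ys) * B) (sym zeros≡))))))
    go : ∀ x → x ∈ xs → x ∈ ys
    go zero    x∈ = zeros>0⇒zero∈ ys (subst (0 <_) zeros≡ (zero∈⇒zeros>0 x∈))
    go (suc x) x∈ = ∈-preds⁻ ys (ΣB^-members (preds xs) (preds ys)
      (≤-<-trans (preds≤length xs) |xs|<B) (≤-<-trans (preds≤length ys) |ys|<B) preds≡ (∈-preds⁺ x∈))

m*M+r≤⇒m≤ : ∀ {m m′ M r} r′ → r′ < M → m * M + r ≤ m′ * M + r′ → m ≤ m′
m*M+r≤⇒m≤ {m} {m′} {M} {r} r′ r′<M le = ≮⇒≥ λ m′<m → <-irrefl refl (begin-strict
  m′ * M + r′   <⟨ +-monoʳ-< (m′ * M) r′<M ⟩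
  m′ * M + M    ≡⟨ +-comm (m′ * M) M ⟩
  suc m′ * M    ≤⟨ *-monoˡ-≤ M m′<m ⟩
  m * M         ≤⟨ m≤m+n (m * M) r ⟩
  m * M + r     ≤⟨ le ⟩
  m′ * M + r′   ∎)
  where open ≤-Reasoning

-- Ends, reversal and repetitions in lists

last-++ : ∀ {A : Set} (a : List A) u c → last (a ++ u ∷ c) ≡ last (u ∷ c)
last-++ []          u c = refl
last-++ (_ ∷ [])    u c = refl
last-++ (_ ∷ x ∷ a) u c = last-++ (x ∷ a) u c

head-++ : ∀ {A : Set} (a : List A) u c c′ → head (a ++ u ∷ c) ≡ head (a ++ u ∷ c′)
head-++ []      u c c′ = refl
head-++ (_ ∷ _) u c c′ = refl

last-init : ∀ {A : Set} {v : A} (p : List A) → last p ≡ just v → ∃ λ q → p ≡ q ∷ʳ v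
last-init (x ∷ [])    refl = [] , refl
last-init (x ∷ y ∷ p) eq   with q , e ← last-init (y ∷ p) eq = x ∷ q , cong (x ∷_) e

head-tail : ∀ {A : Set} {v : A} (p : List A) → head p ≡ just v → ∃ λ q → p ≡ v ∷ q
head-tail (x ∷ p) refl = p , refl

head-reverse : ∀ {A : Set} (p : List A) → head (reverse p) ≡ last p
head-reverse []          = refl
head-reverse (x ∷ [])    = refl
head-reverse (x ∷ y ∷ p) = begin
  head (reverse (x ∷ y ∷ p))           ≡⟨ cong head (unfold-reverse x (y ∷ p)) ⟩
  head (reverse (y ∷ p) ∷ʳ x)          ≡⟨ cong (λ z → head (z ∷ʳ x)) (unfold-reverse y p) ⟩
  head ((reverse p ∷ʳ y) ∷ʳ x)         ≡⟨ cong head (++-assoc (reverse p) [ y ] [ x ]) ⟩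
  head (reverse p ++ y ∷ [ x ])        ≡⟨ head-++ (reverse p) y [ x ] [] ⟩
  head (reverse p ∷ʳ y)                ≡⟨ cong head (sym (unfold-reverse y p)) ⟩
  head (reverse (y ∷ p))               ≡⟨ head-reverse (y ∷ p) ⟩
  last (y ∷ p)                         ∎
  where open ≡-Reasoning

last-reverse : ∀ {A : Set} (p : List A) → last (reverse p) ≡ head p
last-reverse []      = refl
last-reverse (x ∷ p) = trans (cong last (unfold-reverse x p)) (last-++ (reverse p) x [])

reverse-∷∷ : ∀ {A : Set} (u v : A) p → reverse (u ∷ v ∷ p) ≡ reverse p ++ v ∷ [ u ]
reverse-∷∷ u v p = trans (unfold-reverse u (v ∷ p))
  (trans (cong (_∷ʳ u) (unfold-reverse v p)) (++-assoc (reverse p) [ v ] [ u ]))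

lookup-Unique : ∀ {A : Set} {xs : List A} → Unique xs → ∀ i j → i Fin.< j → lookup xs i ≢ lookup xs j
lookup-Unique {xs = x ∷ xs} (x∉ ∷ u) Fin.zero    (Fin.suc j) _         = All.lookup x∉ (∈-lookup j)
lookup-Unique {xs = x ∷ xs} (x∉ ∷ u) (Fin.suc i) (Fin.suc j) (s≤s i<j) = lookup-Unique u i j i<j

Unique⇒length≤ : ∀ {n} {p : List (Fin n)} → Unique p → length p ≤ n
Unique⇒length≤ {n} {p} u = ≮⇒≥ λ n<|p| →
  let i , j , i<j , eq = pigeonhole n<|p| (lookup p) in lookup-Unique u i j i<j eq

module _ {n : ℕ} where

  open DecMembership (Fin._≟_ {n}) using () renaming (_∈?_ to _∈ᶠ?_)

  ¬Unique⇒repeat : ∀ (p : List (Fin n)) → ¬ Unique p →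
    ∃ λ a → ∃ λ u → ∃ λ b → ∃ λ c → p ≡ a ++ u ∷ b ++ u ∷ c
  ¬Unique⇒repeat []      ¬u = ⊥-elim (¬u [])
  ¬Unique⇒repeat (x ∷ p) ¬u with x ∈ᶠ? p
  ... | yes x∈p = let b , c , eq = ∈-∃++ x∈p in [] , x , b , c , cong (x ∷_) eq
  ... | no  x∉p =
    let a , u , b , c , eq = ¬Unique⇒repeat p λ up → ¬u (All.tabulate (λ y∈p x≡y → x∉p (subst (_∈ p) (sym x≡y) y∈p)) ∷ up)
    in x ∷ a , u , b , c , cong (x ∷_) eq

  -- The weights only depend on the unordered pair {u , v}; among increasing walks of equal
  -- length from a common start, the smallest tie is that of the lexicographically largest one.
  base : ℕ
  base = 2 + n

  -- Powers of 3, because a sum of two of them, even equal ones, has no carry in base 3. The falling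
  -- exponent makes edges to larger vertices lighter.
  code : Fin n → ℕ
  code u = 3 ^ (n ∸ toℕ u)

  exponent : Fin n → Fin n → ℕ
  exponent u v = code u + code v

  weight : Fin n → Fin n → ℕ
  weight u v = base ^ exponent u v

  tie : List (Fin n) → ℕ
  tie []          = 0
  tie (u ∷ [])    = 0
  tie (u ∷ v ∷ p) = weight u v + tie (v ∷ p)

  -- No exponent exceeds `3 ^ suc n`, and a simple walk has fewer than `base` edges, so one further
  -- power of `base` lies above the tie of every simple walk. Cost thus compares lengths first.
  scale : ℕ
  scale = base ^ suc (3 ^ suc n)

  cost : List (Fin n) → ℕ
  cost p = length p * scale + tie p

  code-injective : ∀ {u v} → n ∸ toℕ u ≡ n ∸ toℕ v → u ≡ v
  code-injective {u} {v} eq = toℕ-injective (∸-cancelˡ-≡ (<⇒≤ (toℕ<n u)) (<⇒≤ (toℕ<n v)) eq)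

  code-anti : ∀ {u v} → toℕ u < toℕ v → code v < code u
  code-anti {u} {v} u<v = ^-monoʳ-< 3 (s≤s (s≤s z≤n)) (∸-monoʳ-< u<v (<⇒≤ (toℕ<n v)))

  exponent-bound : ∀ u v → exponent u v ≤ 3 ^ suc n
  exponent-bound u v = +-mono-≤ (c u) (≤-trans (c v) (m≤m+n (3 ^ n) _))
    where
    c : ∀ w → code w ≤ 3 ^ n
    c w = ^-monoʳ-≤ 3 (m∸n≤m n (toℕ w))

  exponent-comm : ∀ u v → exponent u v ≡ exponent v u
  exponent-comm u v = +-comm (code u) (code v)

  -- Two summands stay below the base 3, so the digits of the sum reveal the vertices that it was
  -- formed from.
  exponent-endpoint : ∀ {u v x y} → exponent u v ≡ exponent x y → u ≡ x ⊎ u ≡ y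
  exponent-endpoint {u} {v} {x} {y} eq
    with ΣB^-members 3 (n ∸ toℕ u ∷ n ∸ toℕ v ∷ []) (n ∸ toℕ x ∷ n ∸ toℕ y ∷ [])
           ≤-refl ≤-refl
           (trans (cong (code u +_) (+-identityʳ _)) (trans eq (cong (code x +_) (sym (+-identityʳ _))))) (here refl)
  ... | here e         = inj₁ (code-injective e)
  ... | there (here e) = inj₂ (code-injective e)

  exponents : List (Fin n) → List ℕ
  exponents []          = []
  exponents (u ∷ [])    = []
  exponents (u ∷ v ∷ p) = exponent u v ∷ exponents (v ∷ p)

  exponents-length : ∀ p → length (exponents p) ≤ length p
  exponents-length []          = z≤n
  exponents-length (u ∷ [])    = z≤n
  exponents-length (u ∷ v ∷ p) = s≤s (exponents-length (v ∷ p))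

  tie-ΣB^ : ∀ p → tie p ≡ ΣB^ base (exponents p)
  tie-ΣB^ []          = refl
  tie-ΣB^ (u ∷ [])    = refl
  tie-ΣB^ (u ∷ v ∷ p) = cong (weight u v +_) (tie-ΣB^ (v ∷ p))

  ∈-exponents : ∀ {u v} q → exponent u v ∈ exponents q → u ∈ q
  ∈-exponents {u} {v} (x ∷ y ∷ q) (here e) with exponent-endpoint {u} {v} {x} {y} e
  ... | inj₁ refl = here refl
  ... | inj₂ refl = there (here refl)
  ∈-exponents {u} {v} (x ∷ y ∷ q) (there e) = there (∈-exponents {u} {v} (y ∷ q) e)

  tie≤ : ∀ p → tie p ≤ length p * base ^ (3 ^ suc n)
  tie≤ []          = z≤n
  tie≤ (u ∷ [])    = z≤n
  tie≤ (u ∷ v ∷ p) = +-mono-≤ (^-monoʳ-≤ base (exponent-bound u v)) (tie≤ (v ∷ p))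

  tie<scale : ∀ {p} → Unique p → tie p < scale
  tie<scale {p} u = ≤-<-trans (tie≤ p)
    (*-monoˡ-< (base ^ (3 ^ suc n)) {{m^n≢0 base (3 ^ suc n)}} (s≤s (m≤n⇒m≤1+n (Unique⇒length≤ u))))

  cost≤⇒length≤ : ∀ p q → Unique q → cost p ≤ cost q → length p ≤ length q
  cost≤⇒length≤ p q u = m*M+r≤⇒m≤ (tie q) (tie<scale u)

  tie-++ : ∀ a u c → tie (a ++ u ∷ c) ≡ tie (a ∷ʳ u) + tie (u ∷ c)
  tie-++ []          u c = refl
  tie-++ (x ∷ [])    u c = cong (_+ tie (u ∷ c)) (sym (+-identityʳ (weight x u)))
  tie-++ (x ∷ y ∷ a) u c = trans (cong (weight x y +_) (tie-++ (y ∷ a) u c)) (sym (+-assoc (weight x y) _ _))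

  tie-reverse : ∀ p → tie (reverse p) ≡ tie p
  tie-reverse []          = refl
  tie-reverse (u ∷ [])    = refl
  tie-reverse (u ∷ v ∷ p) = begin
    tie (reverse (u ∷ v ∷ p))                   ≡⟨ cong tie (reverse-∷∷ u v p) ⟩
    tie (reverse p ++ v ∷ [ u ])                ≡⟨ tie-++ (reverse p) v [ u ] ⟩
    tie (reverse p ∷ʳ v) + (weight v u + 0)     ≡⟨ cong₂ _+_ (cong tie (sym (unfold-reverse v p))) (+-identityʳ _) ⟩
    tie (reverse (v ∷ p)) + weight v u          ≡⟨ cong₂ _+_ (tie-reverse (v ∷ p)) (cong (base ^_) (exponent-comm v u)) ⟩
    tie (v ∷ p) + weight u v                    ≡⟨ +-comm (tie (v ∷ p)) _ ⟩
    weight u v + tie (v ∷ p)                    ∎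
    where open ≡-Reasoning

  cost-reverse : ∀ p → cost (reverse p) ≡ cost p
  cost-reverse p = cong₂ (λ l t → l * scale + t) (length-reverse p) (tie-reverse p)

  Increasing : List (Fin n) → Set
  Increasing = Linked Fin._<_

  increasing⇒Unique : ∀ {p} → Increasing p → Unique p
  increasing⇒Unique inc = AllPairs.map (λ u<v u≡v → <⇒≢ u<v (cong toℕ u≡v)) (Linked⇒AllPairs <-trans inc)

  -- A geometric-series bound: along an increasing walk the exponents strictly decrease.
  tie-increasing : ∀ {u v p} → Increasing (u ∷ v ∷ p) → tie (u ∷ v ∷ p) < base ^ suc (exponent u v)
  tie-increasing {u} {v} {p} inc = begin-strict
    weight u v + tie (v ∷ p)              <⟨ +-monoʳ-< (weight u v) (tail< inc) ⟩
    weight u v + weight u v               ≤⟨ +-monoʳ-≤ (weight u v) (m≤m+n (weight u v) _) ⟩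
    base * weight u v                     ∎
    where
    open ≤-Reasoning
    tail< : ∀ {u v p} → Increasing (u ∷ v ∷ p) → tie (v ∷ p) < weight u v
    tail< {u} {v} {[]}    _ = m^n>0 base (exponent u v)
    -- Consecutive edges share `v`, and `u < w` makes `code w` smaller than `code u`: the exponent
    -- drops by at least one, which pays for the factor `base` in the bound for the tail.
    tail< {u} {v} {w ∷ p} (u<v ∷ inc@(v<w ∷ _)) = <-≤-trans (tie-increasing inc)
      (^-monoʳ-≤ base (subst (exponent v w <_) (exponent-comm v u)
        (+-monoʳ-< (code v) (code-anti (<-trans u<v v<w)))))

  -- A larger second vertex lowers the first exponent, and the whole increasing walk stays below one
  -- power of `base` more than its first edge, hence at most the first weight of the competitor,
  -- however that one continues.
  tie-larger-child : ∀ {u v v′ p p′} → Increasing (u ∷ v ∷ p) → v′ Fin.< v → tie (u ∷ v ∷ p) < tie (u ∷ v′ ∷ p′)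
  tie-larger-child {u} {v} {v′} {p} {p′} inc v′<v = begin-strict
    tie (u ∷ v ∷ p)               <⟨ tie-increasing inc ⟩
    base ^ suc (exponent u v)     ≤⟨ ^-monoʳ-≤ base (+-monoʳ-< (code u) (code-anti v′<v)) ⟩
    weight u v′                   ≤⟨ m≤m+n (weight u v′) _ ⟩
    tie (u ∷ v′ ∷ p′)             ∎
    where open ≤-Reasoning

module _ {n : ℕ} where

  scale>0 : 0 < scale {n}
  scale>0 = m^n>0 (base {n}) (suc (3 ^ suc n))

  cost-mono : ∀ {p q : List (Fin n)} → length p ≤ length q → tie p < tie q → cost p < cost q
  cost-mono l t = +-mono-≤-< (*-monoˡ-≤ (scale {n}) l) t

  -- The shared vertex `u` is charged to the right part here and to the left part in `cost-++ʳ`, so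
  -- that either part can be exchanged while the rest contributes a constant.
  cost-++ : ∀ (a : List (Fin n)) u c → cost (a ++ u ∷ c) ≡ (length a * scale {n} + tie (a ∷ʳ u)) + cost (u ∷ c)
  cost-++ a u c = begin
    length (a ++ u ∷ c) * K + tie (a ++ u ∷ c)
      ≡⟨ cong₂ (λ l t → l * K + t) (length-++ a) (tie-++ a u c) ⟩
    (length a + L) * K + (tie (a ∷ʳ u) + tie (u ∷ c))
      ≡⟨ cong (_+ (tie (a ∷ʳ u) + tie (u ∷ c))) (*-distribʳ-+ K (length a) L) ⟩
    (length a * K + L * K) + (tie (a ∷ʳ u) + tie (u ∷ c))
      ≡⟨ interchange +-commutativeSemigroup (length a * K) (L * K) (tie (a ∷ʳ u)) (tie (u ∷ c)) ⟩
    (length a * K + tie (a ∷ʳ u)) + (L * K + tie (u ∷ c)) ∎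
    where
    open ≡-Reasoning
    K = scale {n}
    L = suc (length c)

  cost-++ʳ : ∀ (a : List (Fin n)) u c → cost (a ++ u ∷ c) ≡ cost (a ∷ʳ u) + (length c * scale {n} + tie (u ∷ c))
  cost-++ʳ a u c = begin
    cost (a ++ u ∷ c)                               ≡⟨ cost-++ a u c ⟩
    x + cost (u ∷ c)                                ≡⟨ cong (x +_) (+-assoc K (length c * K) (tie (u ∷ c))) ⟩
    x + (K + y)                                     ≡⟨ sym (+-assoc x K y) ⟩
    (x + K) + y
      ≡⟨ cong (λ z → x + z + y) (sym (trans (+-identityʳ (K + 0)) (+-identityʳ K))) ⟩
    (x + cost [ u ]) + y                            ≡⟨ cong (_+ y) (sym (cost-++ a u [])) ⟩
    cost (a ∷ʳ u) + y                               ∎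
    where
    open ≡-Reasoning
    K = scale {n}
    x = length a * K + tie (a ∷ʳ u)
    y = length c * K + tie (u ∷ c)

  cost-cut-loop : ∀ (a : List (Fin n)) u b c → cost (a ++ u ∷ c) < cost (a ++ u ∷ b ++ u ∷ c)
  cost-cut-loop a u b c = begin-strict
    cost (a ++ u ∷ c)                               ≡⟨ cost-++ a u c ⟩
    x + cost (u ∷ c)                                <⟨ +-monoʳ-< x (m<n+m (cost (u ∷ c)) positive) ⟩
    x + (y + cost (u ∷ c))                          ≡⟨ cong (x +_) (sym (cost-++ (u ∷ b) u c)) ⟩
    x + cost (u ∷ b ++ u ∷ c)                       ≡⟨ sym (cost-++ a u (b ++ u ∷ c)) ⟩
    cost (a ++ u ∷ b ++ u ∷ c)                      ∎
    where
    open ≤-Reasoning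
    x = length a * scale {n} + tie (a ∷ʳ u)
    y = length (u ∷ b) * scale {n} + tie ((u ∷ b) ∷ʳ u)
    positive : 0 < y
    positive = <-≤-trans scale>0 (≤-trans (m≤m+n (scale {n}) _) (m≤m+n _ _))

  candidates : ℕ → List (List (Fin n))
  candidates zero    = [ [] ]
  candidates (suc m) = [] ∷ cartesianProductWith _∷_ (allFin n) (candidates m)

  ∈-candidates : ∀ m p → length p ≤ m → p ∈ candidates m
  ∈-candidates zero    []      _         = here refl
  ∈-candidates (suc m) []      _         = here refl
  ∈-candidates (suc m) (x ∷ p) (s≤s |p|≤m) =
    there (∈-cartesianProductWith⁺ _∷_ (∈-allFin x) (∈-candidates m p |p|≤m))

  Consec-∷ : ∀ {x y z : Fin n} {p} → Consec x y p → Consec x y (z ∷ p)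
  Consec-∷ {z = z} (a , b , eq) = z ∷ a , b , cong (z ∷_) eq

-- Walks avoiding the faults, and exchange arguments for cheapest ones

module _ {k n} (G : Graph k n) where

  -- `IsPath` with its start expressed by `head`: both ends get the same form, so reversal swaps
  -- them and the predicate is decidable field by field.
  record Walk (F : BRel n) (s t : Fin n) (p : List (Fin n)) : Set where
    constructor walk
    field
      starts : head p ≡ just s
      ends   : last p ≡ just t
      steps  : Steps G F p
  open Walk

  fromPath : ∀ {F s t p} → IsPath G F s t p → Walk F s t p
  fromPath ((r , refl) , e , st) = walk refl e st

  toPath : ∀ {F s t p} → Walk F s t p → IsPath G F s t p
  toPath {p = p} (walk h e st) = head-tail p h , e , st

  steps? : ∀ F p → Dec (Steps G F p)
  steps? F []          = yes tt
  steps? F (u ∷ [])    = yes tt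
  steps? F (u ∷ v ∷ p) = (adj G u v Bool.≟ true) ×-dec (F u v Bool.≟ false) ×-dec steps? F (v ∷ p)

  walk? : ∀ F s t p → Dec (Walk F s t p)
  walk? F s t p = map′ (λ (h , e , st) → walk h e st) (λ (walk h e st) → h , e , st)
    (Maybe.≡-dec _≟_ (head p) (just s) ×-dec Maybe.≡-dec _≟_ (last p) (just t) ×-dec steps? F p)

  steps-++⁻ : ∀ {F} a u c → Steps G F (a ++ u ∷ c) → Steps G F (a ∷ʳ u) × Steps G F (u ∷ c)
  steps-++⁻ []          u c st = tt , st
  steps-++⁻ (x ∷ [])    u c (e , f , st) = (e , f , tt) , st
  steps-++⁻ (x ∷ y ∷ a) u c (e , f , st) = let l , r = steps-++⁻ (y ∷ a) u c st in (e , f , l) , r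

  steps-++⁺ : ∀ {F} a u c → Steps G F (a ∷ʳ u) → Steps G F (u ∷ c) → Steps G F (a ++ u ∷ c)
  steps-++⁺ []          u c _ r = r
  steps-++⁺ (x ∷ [])    u c (e , f , _) r = e , f , r
  steps-++⁺ (x ∷ y ∷ a) u c (e , f , l) r = e , f , steps-++⁺ (y ∷ a) u c l r

  -- Serves both directions of stability: dropping a fault keeps every walk, adding one keeps the
  -- walks that do not use it.
  steps-refault : ∀ {F F′} p → Steps G F p → (∀ x y → Consec x y p → F x y ≡ false → F′ x y ≡ false) → Steps G F′ p
  steps-refault []          _ _ = tt
  steps-refault (u ∷ [])    _ _ = tt
  steps-refault (u ∷ v ∷ p) (e , f , st) h =
    e , h u v ([] , p , refl) f , steps-refault (v ∷ p) st (λ x y → h x y ∘ Consec-∷)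

  walk-replace-suffix : ∀ {F s t} a u {c c′} → Walk F s t (a ++ u ∷ c) → Walk F u t (u ∷ c′) → Walk F s t (a ++ u ∷ c′)
  walk-replace-suffix a u {c} {c′} (walk h e st) (walk _ e′ st′) = walk
    (trans (head-++ a u c′ c) h) (trans (last-++ a u c′) e′) (steps-++⁺ a u c′ (proj₁ (steps-++⁻ a u c st)) st′)

  walk-replace-prefix : ∀ {F s t a a′} v c → Walk F s t (a ++ v ∷ c) → Walk F s v (a′ ∷ʳ v) → Walk F s t (a′ ++ v ∷ c)
  walk-replace-prefix {a = a} {a′} v c (walk h e st) (walk h′ _ st′) = walk
    (trans (head-++ a′ v c []) h′) (trans (last-++ a′ v c) (trans (sym (last-++ a v c)) e))
    (steps-++⁺ a′ v c st′ (proj₂ (steps-++⁻ a v c st)))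

  walk-suffix : ∀ {F s t} a u c → Walk F s t (a ++ u ∷ c) → Walk F u t (u ∷ c)
  walk-suffix a u c (walk h e st) = walk refl (trans (sym (last-++ a u c)) e) (proj₂ (steps-++⁻ a u c st))

  walk-prefix : ∀ {F s t} a u c → Walk F s t (a ++ u ∷ c) → Walk F s u (a ∷ʳ u)
  walk-prefix a u c (walk h e st) = walk (trans (head-++ a u [] c) h) (last-++ a u []) (proj₁ (steps-++⁻ a u c st))

  walk-cut-loop : ∀ {F s t} a u b c → Walk F s t (a ++ u ∷ b ++ u ∷ c) → Walk F s t (a ++ u ∷ c)
  walk-cut-loop a u b c w = walk-replace-suffix a u w (walk-suffix (u ∷ b) u c (walk-suffix a u (b ++ u ∷ c) w))

  -- Cutting out a loop leaves a walk that is both shorter and cheaper; `m` bounds the length and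
  -- drives the recursion.
  simplify : ∀ {F s t} m p → length p ≤ m → Walk F s t p →
    ∃ λ q → Walk F s t q × Unique q × length q ≤ length p × cost q ≤ cost p
  simplify zero    []      _      (walk () _ _)
  simplify (suc m) p       |p|≤1+m w with Unique?.unique? _≟_ p
  ... | yes u = p , w , u , ≤-refl , ≤-refl
  ... | no ¬u with a , u , b , c , refl ← ¬Unique⇒repeat p ¬u =
    let q , wq , uq , lq , cq = simplify m (a ++ u ∷ c) (≤-pred (≤-trans (shorter a u b c) |p|≤1+m)) (walk-cut-loop a u b c w)
    in q , wq , uq , ≤-trans lq (<⇒≤ (shorter a u b c)) , ≤-trans cq (<⇒≤ (cost-cut-loop a u b c))
    where
    shorter : ∀ (a : List (Fin n)) u b c → length (a ++ u ∷ c) < length (a ++ u ∷ b ++ u ∷ c)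
    shorter a u b c = begin-strict
      length (a ++ u ∷ c)              ≡⟨ length-++ a ⟩
      length a + suc (length c)        <⟨ +-monoʳ-< (length a) (s≤s (m≤n+m (suc (length c)) (length b))) ⟩
      length a + suc (length b + suc (length c)) ≡⟨ cong (λ l → length a + suc l) (sym (length-++ b)) ⟩
      length a + length (u ∷ b ++ u ∷ c) ≡⟨ sym (length-++ a) ⟩
      length (a ++ u ∷ b ++ u ∷ c) ∎
      where open ≤-Reasoning

  -- Minimality is over all walks, including those with repeated vertices, so that spliced walks can
  -- be compared without checking that they are simple.
  Best : BRel n → Fin n → Fin n → List (Fin n) → Set
  Best F s t p = Walk F s t p × (∀ q → Walk F s t q → cost p ≤ cost q)

  best⇒Unique : ∀ {F s t p} → Best F s t p → Unique p
  best⇒Unique {p = p} (w , min) with Unique?.unique? _≟_ p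
  ... | yes u = u
  ... | no ¬u with a , u , b , c , refl ← ¬Unique⇒repeat p ¬u =
    ⊥-elim (<⇒≱ (cost-cut-loop a u b c) (min _ (walk-cut-loop a u b c w)))

  -- A cheaper continuation from `u` could be spliced in behind `a`.
  best-suffix : ∀ {F s t} a u c → Best F s t (a ++ u ∷ c) → Best F u t (u ∷ c)
  best-suffix {F} {s} {t} a u c (w , min) = walk-suffix a u c w , λ q wq → go q wq (head-tail q (starts wq))
    where
    go : ∀ q → Walk F u t q → ∃ (λ q′ → q ≡ u ∷ q′) → cost (u ∷ c) ≤ cost q
    go .(u ∷ q′) wq (q′ , refl) = +-cancelˡ-≤ (length a * scale {n} + tie (a ∷ʳ u)) _ _
      (subst₂ _≤_ (cost-++ a u c) (cost-++ a u q′) (min _ (walk-replace-suffix a u w wq)))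

  best-prefix : ∀ {F s t} a v c → Best F s t (a ++ v ∷ c) → Best F s v (a ∷ʳ v)
  best-prefix {F} {s} a v c (w , min) = walk-prefix a v c w , λ q wq → go q wq (last-init q (ends wq))
    where
    go : ∀ q → Walk F s v q → ∃ (λ q′ → q ≡ q′ ∷ʳ v) → cost (a ∷ʳ v) ≤ cost q
    go .(q′ ∷ʳ v) wq (q′ , refl) = +-cancelʳ-≤ (length c * scale {n} + tie (v ∷ c)) _ _
      (subst₂ _≤_ (cost-++ʳ a v c) (cost-++ʳ q′ v c) (min _ (walk-replace-prefix v c w wq)))

  best-cost : ∀ {F s t} p q → Best F s t p → Best F s t q → cost p ≡ cost q
  best-cost p q (w , m) (w′ , m′) = ≤-antisym (m q w′) (m′ p w)

  -- Both walks are simple, so equal costs give equal lengths, and what remains of the costs are the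
  -- ties.
  best-tie : ∀ {F s t} p q → Best F s t p → Best F s t q → tie p ≡ tie q
  best-tie p q bp bq = +-cancelˡ-≡ (length p * scale {n}) _ _
    (trans (best-cost p q bp bq) (cong (λ l → l * scale {n} + tie q) (sym |p|≡|q|)))
    where
    |p|≡|q| : length p ≡ length q
    |p|≡|q| = ≤-antisym (cost≤⇒length≤ p q (best⇒Unique bq) (≤-reflexive (best-cost p q bp bq)))
                        (cost≤⇒length≤ q p (best⇒Unique bp) (≤-reflexive (best-cost q p bq bp)))

  -- Otherwise the first edge of one walk would have to reappear later in the other, which
  -- would then visit s twice.
  best-first-step : ∀ {F s t v v′ p q} → Best F s t (s ∷ v ∷ p) → Best F s t (s ∷ v′ ∷ q) → v ≡ v′
  best-first-step {F} {s} {t} {v} {v′} {p} {q} bp bq =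
    repeats (ΣB^-members (base {n}) (exponents (s ∷ v ∷ p)) (exponents (s ∷ v′ ∷ q))
      (short (s ∷ v ∷ p) (best⇒Unique bp)) (short (s ∷ v′ ∷ q) (best⇒Unique bq))
      (trans (sym (tie-ΣB^ (s ∷ v ∷ p))) (trans (best-tie (s ∷ v ∷ p) (s ∷ v′ ∷ q) bp bq) (tie-ΣB^ (s ∷ v′ ∷ q)))) (here refl))
    where
    short : ∀ r → Unique r → length (exponents r) < base {n}
    short r u = s≤s (m≤n⇒m≤1+n (≤-trans (exponents-length r) (Unique⇒length≤ u)))
    repeats : exponent s v ∈ exponents (s ∷ v′ ∷ q) → v ≡ v′
    repeats (there e) = ⊥-elim (Unique.Unique[x∷xs]⇒x∉xs (best⇒Unique bq) (∈-exponents {u = s} {v = v} (v′ ∷ q) e))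
    repeats (here e)  with exponent-endpoint {u = v} {s} {s} {v′} (trans (exponent-comm v s) e)
    ... | inj₁ refl = ⊥-elim (Unique.Unique[x∷xs]⇒x∉xs (best⇒Unique bp) (here refl))
    ... | inj₂ eq   = eq

  tie-positive : ∀ (u v : Fin n) p → 0 < tie (u ∷ v ∷ p)
  tie-positive u v p = <-≤-trans (m^n>0 (base {n}) (exponent u v)) (m≤m+n (weight u v) (tie (v ∷ p)))

  best-unique : ∀ {F s t} p q → Best F s t p → Best F s t q → p ≡ q
  best-unique []          q           (walk () _ _ , _) _
  best-unique (s ∷ p)     []          _ (walk () _ _ , _)
  best-unique (s ∷ [])    (.s ∷ [])   (walk refl _ _ , _) (walk refl _ _ , _) = refl
  best-unique (s ∷ [])    (.s ∷ v ∷ q) bp@(walk refl refl _ , _) bq@(walk refl _ _ , _) =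
    ⊥-elim (<⇒≢ (tie-positive s v q) (best-tie [ s ] (s ∷ v ∷ q) bp bq))
  best-unique (s ∷ v ∷ p) (.s ∷ [])   bp@(walk refl _ _ , _) bq@(walk refl _ _ , _) =
    ⊥-elim (<⇒≢ (tie-positive s v p) (best-tie [ s ] (s ∷ v ∷ p) bq bp))
  best-unique {F} {t = t} (s ∷ v ∷ p) (.s ∷ v′ ∷ q) bp@(walk refl _ _ , _) bq@(walk refl _ _ , _) =
    cong (s ∷_) (best-unique (v ∷ p) (v′ ∷ q) (best-suffix [ s ] v p bp)
      (subst (λ w → Best F w t (v′ ∷ q)) (sym (best-first-step bp bq)) (best-suffix [ s ] v′ q bq)))

  -- The scheme that selects the cheapest walk

  cheapest : List (List (Fin n)) → Maybe (List (Fin n))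
  cheapest []       = nothing
  cheapest (p ∷ ps) = just (argmin cost p ps)

  scheme : Scheme n
  scheme s t F = cheapest (filter (walk? F s t) (candidates n))

  Selected : BRel n → Fin n → Fin n → Maybe (List (Fin n)) → Set
  Selected F s t (just p) = Best F s t p
  Selected F s t nothing  = ∀ q → ¬ Walk F s t q

  selected : ∀ F s t → Selected F s t (scheme s t F)
  selected F s t = go (filter (walk? F s t) (candidates n)) (All.all-filter (walk? F s t) (candidates n)) λ w u →
    ∈-filter⁺ (walk? F s t) (∈-candidates n _ (Unique⇒length≤ u)) w
    where
    go : ∀ ps → All.All (Walk F s t) ps → (∀ {q} → Walk F s t q → Unique q → q ∈ ps) → Selected F s t (cheapest ps)
    go []       _            complete q w with _ , wq , uq , _ ← simplify (length q) q ≤-refl w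
      with () ← complete wq uq
    go (p ∷ ps) (wp All.∷ ws) complete = argmin-all cost {P = Walk F s t} wp ws , λ q w →
      -- A walk with repetitions may be too long to be a candidate; its simplification is a
      -- candidate and costs no more.
      let q′ , wq , uq , _ , c = simplify (length q) q ≤-refl w in ≤-trans (least (complete wq uq)) c
      where
      least : ∀ {q} → q ∈ p ∷ ps → cost (argmin cost p ps) ≤ cost q
      least (here refl) = f[argmin]≤f[⊤] {f = cost} p ps
      least (there q∈)  = All.lookup (f[argmin]≤f[xs] {f = cost} p ps) q∈

  scheme-just : ∀ {F s t p} → Best F s t p → scheme s t F ≡ just p
  scheme-just {F} {s} {t} bp@(wp , _) with scheme s t F | selected F s t
  ... | just q  | bq   = cong just (best-unique _ _ bq bp)
  ... | nothing | none = ⊥-elim (none _ wp)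

  scheme-nothing : ∀ {F s t} → (∀ q → ¬ Walk F s t q) → scheme s t F ≡ nothing
  scheme-nothing {F} {s} {t} none with scheme s t F | selected F s t
  ... | just q  | bq = ⊥-elim (none q (proj₁ bq))
  ... | nothing | _  = refl

  scheme-best : ∀ {F s t p} → scheme s t F ≡ just p → Best F s t p
  scheme-best {F} {s} {t} eq = subst (Selected F s t) eq (selected F s t)

  scheme-isRPTS : IsRPTS G scheme
  scheme-isRPTS F _ s t with scheme s t F | selected F s t
  ... | nothing | none        = λ q → none q ∘ fromPath
  ... | just p  | (w , least) = toPath w , λ q wq →
    -- Cost controls length only against a simple walk, whose tie is below `scale`.
    let q′ , wq′ , uq′ , l , _ = simplify (length q) q ≤-refl (fromPath wq)
    in ≤-trans (cost≤⇒length≤ p q′ uq′ (least q′ wq′)) l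

  scheme-consistent : Consistent G scheme
  scheme-consistent F _ s t a u b v c eq =
    u ∷ b ∷ʳ v , scheme-just (best-prefix (u ∷ b) v c (best-suffix a u (b ++ v ∷ c) (scheme-best eq))) ,
    a , c , cong (λ r → a ++ u ∷ r) (sym (++-assoc b [ v ] c))

  addE-false : ∀ (F : BRel n) u v x y → addE k F u v x y ≡ false → F x y ≡ false
  addE-false = go k
    where
    go : ∀ k (F : BRel n) u v x y → addE k F u v x y ≡ false → F x y ≡ false
    go directed   F u v x y eq with F x y
    ... | false = refl
    go undirected F u v x y eq with F x y
    ... | false = refl

  OnPath-addE : ∀ (F : BRel n) u v x y {p} → ¬ OnPath k u v p → Consec x y p → F x y ≡ false → addE k F u v x y ≡ false
  OnPath-addE = go k
    where
    go : ∀ k (F : BRel n) u v x y {p} → ¬ OnPath k u v p → Consec x y p → F x y ≡ false → addE k F u v x y ≡ false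
    go directed   F u v x y ¬on on eq rewrite eq with x ≟ u | y ≟ v
    ... | yes refl | yes refl = ⊥-elim (¬on on)
    ... | yes _    | no _     = refl
    ... | no _     | _        = refl
    go undirected F u v x y ¬on on eq rewrite eq with x ≟ u | y ≟ v | x ≟ v | y ≟ u
    ... | yes refl | yes refl | _        | _        = ⊥-elim (¬on (inj₁ on))
    ... | _        | _        | yes refl | yes refl = ⊥-elim (¬on (inj₂ on))
    ... | yes _    | no _     | no _     | _        = refl
    ... | yes _    | no _     | yes _    | no _     = refl
    ... | no _     | _        | no _     | _        = refl
    ... | no _     | _        | yes _    | no _     = refl

  -- The selected walk avoids the new fault and survives, while every walk that remains was already
  -- among its competitors.
  scheme-stable : Stable G scheme
  scheme-stable F _ s t u v _ ¬on with scheme s t F in eq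
  ... | nothing = sym (scheme-nothing λ q (walk h e st) →
    subst (Selected F s t) eq (selected F s t) q (walk h e (steps-refault q st λ x y _ → addE-false F u v x y)))
  ... | just p with (walk h e st , least) ← scheme-best {p = p} eq = sym (scheme-just {p = p}
    (walk h e (steps-refault p st λ x y → OnPath-addE F u v x y ¬on) ,
     λ q (walk h′ e′ st′) → least q (walk h′ e′ (steps-refault q st′ λ x y _ → addE-false F u v x y))))

  module _ (k≡u : k ≡ undirected) where

    steps-reverse : ∀ {F} → ValidF G F → ∀ p → Steps G F p → Steps G F (reverse p)
    steps-reverse valid []          _ = tt
    steps-reverse valid (u ∷ [])    _ = tt
    steps-reverse {F} valid (u ∷ v ∷ p) (e , f , st) = subst (Steps G F) (sym (reverse-∷∷ u v p))
      (steps-++⁺ (reverse p) v [ u ] (subst (Steps G F) (unfold-reverse v p) (steps-reverse valid (v ∷ p) st))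
        (trans (symm G k≡u v u) e , trans (proj₂ valid k≡u v u) f , tt))

    walk-reverse : ∀ {F s t p} → ValidF G F → Walk F s t p → Walk F t s (reverse p)
    walk-reverse {p = p} valid (walk h e st) =
      walk (trans (head-reverse p) e) (trans (last-reverse p) h) (steps-reverse valid p st)

    scheme-symmetric : Symmetric G scheme
    scheme-symmetric F valid s t with scheme s t F in eq
    ... | nothing = scheme-nothing {F} λ q w → subst (Selected F s t) eq (selected F s t) (reverse q) (walk-reverse valid w)
    ... | just p with (w , least) ← scheme-best eq = scheme-just {p = reverse p} (walk-reverse valid w , λ q wq →
      subst₂ _≤_ (sym (cost-reverse p)) (cost-reverse q) (least (reverse q) (walk-reverse valid wq)))

-- Layered forests

-- The index is the common depth of all leaves, so a distance gap between leaves cannot even be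
-- expressed.
data Tree : ℕ → Set where
  leaf : Tree 0
  un   : ∀ {d} → Tree d → Tree (suc d)
  bin  : ∀ {d} → Tree d → Tree d → Tree (suc d)

nodes : ∀ {d} → Tree d → ℕ
nodes leaf      = 1
nodes (un t)    = suc (nodes t)
nodes (bin l r) = suc (nodes l + nodes r)

nodes>0 : ∀ {d} (t : Tree d) → 0 < nodes t
nodes>0 leaf      = z<s
nodes>0 (un t)    = z<s
nodes>0 (bin l r) = z<s

data Leaf : ∀ {d} → Tree d → Set where
  here  : Leaf leaf
  down  : ∀ {d} {t : Tree d} → Leaf t → Leaf (un t)
  left  : ∀ {d} {l r : Tree d} → Leaf l → Leaf (bin l r)
  right : ∀ {d} {l r : Tree d} → Leaf r → Leaf (bin l r)

-- Nodes are numbered in preorder, the root being o.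
pos : ∀ {d} {t : Tree d} → Leaf t → ℕ → ℕ
pos here              o = o
pos (down ℓ)          o = pos ℓ (suc o)
pos (left ℓ)          o = pos ℓ (suc o)
pos (right {l = l} ℓ) o = pos ℓ (suc o + nodes l)

≤ᵇ-true : ∀ {m n} → m ≤ n → (m ≤ᵇ n) ≡ true
≤ᵇ-true {m} {n} le with m ≤ᵇ n | ≤⇒≤ᵇ le
... | true | _ = refl

≤ᵇ-true⁻ : ∀ {m n} → (m ≤ᵇ n) ≡ true → m ≤ n
≤ᵇ-true⁻ {m} {n} eq = ≤ᵇ⇒≤ m n (subst T (sym eq) tt)

≡ᵇ-true : ∀ m → (m ≡ᵇ m) ≡ true
≡ᵇ-true zero    = refl
≡ᵇ-true (suc m) = ≡ᵇ-true m

≡ᵇ-true⁻ : ∀ {m n} → (m ≡ᵇ n) ≡ true → m ≡ n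
≡ᵇ-true⁻ {m} {n} eq = ≡ᵇ⇒≡ m n (subst T (sym eq) tt)

∨-true⁻ : ∀ {a b} → (a ∨ b) ≡ true → a ≡ true ⊎ b ≡ true
∨-true⁻ {true}  _  = inj₁ refl
∨-true⁻ {false} eq = inj₂ eq

∨-true⁺ˡ : ∀ {a b} → a ≡ true → (a ∨ b) ≡ true
∨-true⁺ˡ refl = refl

∨-true⁺ʳ : ∀ {a b} → b ≡ true → (a ∨ b) ≡ true
∨-true⁺ʳ {true}  _  = refl
∨-true⁺ʳ {false} eq = eq

¬true : ∀ {b} → ¬ (b ≡ true) → b ≡ false
¬true {false} _ = refl
¬true {true}  h = ⊥-elim (h refl)

-- A node is given by its level and the characteristic function of its set of successors.
Node : Set
Node = ℕ × (ℕ → Bool)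

unary : ℕ → ℕ → Bool
unary o v = v ≡ᵇ suc o

binary : ℕ → ℕ → ℕ → Bool
binary o m v = (v ≡ᵇ suc o) ∨ (v ≡ᵇ suc o + m)

-- All numbers from β on are the common successors of all leaves.
module Layered (node : ℕ → Node) (β D : ℕ) where

  level : ℕ → ℕ
  level u = proj₁ (node u)

  edge : ℕ → ℕ → Bool
  edge u = proj₂ (node u)

  Climbing : Set
  Climbing = ∀ {u v} → edge u v ≡ true → u < v × level v ≡ suc (level u)

  SinkLevel : Set
  SinkLevel = ∀ {v} → β ≤ v → level v ≡ suc D

  -- States that the numbering `node` contains a copy of the tree on consecutive numbers from `o`
  -- on, with its root at level `l`.
  Rooted : ∀ {d} → Tree d → ℕ → ℕ → Set
  Rooted leaf      o l = node o ≡ (l , (β ≤ᵇ_))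
  Rooted (un t)    o l = node o ≡ (l , unary o) × Rooted t (suc o) (suc l)
  Rooted (bin a b) o l = node o ≡ (l , binary o (nodes a)) × Rooted a (suc o) (suc l) × Rooted b (suc o + nodes a) (suc l)

  rooted-level : ∀ {d} (t : Tree d) {o l} → Rooted t o l → level o ≡ l
  rooted-level leaf      eq       = cong proj₁ eq
  rooted-level (un _)    (eq , _) = cong proj₁ eq
  rooted-level (bin _ _) (eq , _) = cong proj₁ eq

  edge≡ : ∀ {o l s} → node o ≡ (l , s) → ∀ v → edge o v ≡ s v
  edge≡ eq v = cong (λ x → proj₂ x v) eq

  module _ (sink-level : SinkLevel) where

    -- The offset `i` is sorted into root, left or right subtree. The equation `l + d ≡ D` puts the
    -- leaves one level below the sinks, and the bound by `β` makes the edges to the sinks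
    -- increasing.
    rooted-edge : ∀ {d} (t : Tree d) {o l} → Rooted t o l → l + d ≡ D → o + nodes t ≤ β →
      ∀ i {v} → i < nodes t → edge (o + i) v ≡ true → o + i < v × level v ≡ suc (level (o + i))
    rooted-edge leaf {o} {l} eq l+0≡D bnd zero {v} _ e rewrite +-identityʳ o =
      <-≤-trans (subst (_≤ β) (+-comm o 1) bnd) β≤v ,
      trans (sink-level β≤v) (cong suc (sym (trans (cong proj₁ eq) (trans (sym (+-identityʳ l)) l+0≡D))))
      where β≤v = ≤ᵇ-true⁻ (trans (sym (edge≡ eq v)) e)
    rooted-edge leaf eq _ bnd (suc i) (s≤s ()) e
    rooted-edge (un t) {o} {l} (eq , rt) l+d≡D bnd zero {v} _ e rewrite +-identityʳ o
      with refl ← ≡ᵇ-true⁻ {v} {suc o} (trans (sym (edge≡ eq v)) e) =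
      ≤-refl , trans (rooted-level t rt) (cong suc (sym (cong proj₁ eq)))
    rooted-edge (un t) {o} {l} (eq , rt) l+d≡D bnd (suc i) {v} (s≤s i<) e rewrite +-suc o i =
      rooted-edge t rt (trans (sym (+-suc l _)) l+d≡D) (subst (_≤ β) (+-suc o (nodes t)) bnd) i i< e
    rooted-edge (bin a b) {o} {l} (eq , ra , rb) l+d≡D bnd zero {v} _ e rewrite +-identityʳ o
      with ∨-true⁻ {v ≡ᵇ suc o} (trans (sym (edge≡ eq v)) e)
    ... | inj₁ h with refl ← ≡ᵇ-true⁻ {v} {suc o} h =
      ≤-refl , trans (rooted-level a ra) (cong suc (sym (cong proj₁ eq)))
    ... | inj₂ h with refl ← ≡ᵇ-true⁻ {v} {suc o + nodes a} h =
      s≤s (m≤m+n o _) , trans (rooted-level b rb) (cong suc (sym (cong proj₁ eq)))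
    rooted-edge (bin a b) {o} {l} (eq , ra , rb) l+d≡D bnd (suc i) {v} (s≤s i<) e
      rewrite +-suc o i | +-suc o (nodes a + nodes b) with i <? nodes a
    ... | yes i<a = rooted-edge a ra (trans (sym (+-suc l _)) l+d≡D)
                      (≤-trans (s≤s (+-monoʳ-≤ o (m≤m+n (nodes a) (nodes b)))) bnd) i i<a e
    ... | no i≮a = subst (λ w → w < v × level v ≡ suc (level w)) eq′
        (rooted-edge b rb (trans (sym (+-suc l _)) l+d≡D)
          (subst (_≤ β) (cong suc (sym (+-assoc o (nodes a) (nodes b)))) bnd) (i ∸ nodes a)
          (+-cancelˡ-< (nodes a) _ _ (subst (_< nodes a + nodes b) (sym (m+[n∸m]≡n (≮⇒≥ i≮a))) i<))
          (subst (λ w → edge w v ≡ true) (sym eq′) e))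
      where
      eq′ : suc o + nodes a + (i ∸ nodes a) ≡ suc (o + i)
      eq′ = cong suc (trans (+-assoc o (nodes a) _) (cong (o +_) (m+[n∸m]≡n (≮⇒≥ i≮a))))

  -- At each left turn the edge to the right is cut, and no edge on the way to the leaf is.
  Fits : (ℕ → ℕ → Bool) → ∀ {d} {t : Tree d} → Leaf t → ℕ → Set
  Fits C here              o = ∀ v → C o v ≡ false
  Fits C (down ℓ)          o = C o (suc o) ≡ false × Fits C ℓ (suc o)
  Fits C (left {l = l} ℓ)  o = C o (suc o) ≡ false × C o (suc o + nodes l) ≡ true × Fits C ℓ (suc o)
  Fits C (right {l = l} ℓ) o = C o (suc o + nodes l) ≡ false × Fits C ℓ (suc o + nodes l)

-- The graph of the forest and the walk that a set of faults forces

orient : Kind → (ℕ → ℕ → Bool) → ∀ {n} → BRel n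
orient directed   R u v = R (toℕ u) (toℕ v)
orient undirected R u v = R (toℕ u) (toℕ v) ∨ R (toℕ v) (toℕ u)

orient-symm : ∀ k R {n} → k ≡ undirected → ∀ (u v : Fin n) → orient k R u v ≡ orient k R v u
orient-symm undirected R refl u v = ∨-comm (R (toℕ u) (toℕ v)) _

orient-⊆ : ∀ k {R R′} {n} → (∀ u v → R u v ≡ true → R′ u v ≡ true) →
  ∀ (u v : Fin n) → orient k R u v ≡ true → orient k R′ u v ≡ true
orient-⊆ directed   h u v e = h _ _ e
orient-⊆ undirected {R} h u v e with ∨-true⁻ {R (toℕ u) (toℕ v)} e
... | inj₁ e′ = ∨-true⁺ˡ (h _ _ e′)
... | inj₂ e′ = ∨-true⁺ʳ (h _ _ e′)

orient⁺ : ∀ k R {n} (u v : Fin n) → R (toℕ u) (toℕ v) ≡ true → orient k R u v ≡ true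
orient⁺ directed   R u v e = e
orient⁺ undirected R u v e = ∨-true⁺ˡ e

orient⁻ : ∀ k R {n} (u v : Fin n) → orient k R u v ≡ true → R (toℕ u) (toℕ v) ≡ true ⊎ R (toℕ v) (toℕ u) ≡ true
orient⁻ directed   R u v e = inj₁ e
orient⁻ undirected R u v e = ∨-true⁻ e

module Network (node : ℕ → Node) (β D : ℕ) (climbs : Layered.Climbing node β D)
  (sink-level : Layered.SinkLevel node β D) (k : Kind) (n : ℕ) where

  open Layered node β D

  edge-< : ∀ {u v} → edge u v ≡ true → u < v
  edge-< e = proj₁ (climbs e)

  edge-level : ∀ {u v} → edge u v ≡ true → level v ≡ suc (level u)
  edge-level e = proj₂ (climbs e)

  network : Graph k n
  network = record
    { adj      = orient k edge
    ; loopless = λ u → ¬true λ e → <-irrefl refl (loop u (orient⁻ k edge u u e))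
    ; symm     = orient-symm k edge
    }
    where
    loop : ∀ (u : Fin n) → edge (toℕ u) (toℕ u) ≡ true ⊎ edge (toℕ u) (toℕ u) ≡ true → toℕ u < toℕ u
    loop u (inj₁ e) = edge-< e
    loop u (inj₂ e) = edge-< e

  lev : Fin n → ℕ
  lev u = level (toℕ u)

  adj-lev : ∀ u v → adj network u v ≡ true → lev v ≤ suc (lev u)
  adj-lev u v e with orient⁻ k edge u v e
  ... | inj₁ e′ = ≤-reflexive (edge-level e′)
  ... | inj₂ e′ = m≤n⇒m≤1+n (≤-trans (n≤1+n (lev v)) (≤-reflexive (sym (edge-level e′))))

  adj-up : ∀ u v → adj network u v ≡ true → lev u < lev v → edge (toℕ u) (toℕ v) ≡ true
  adj-up u v e u<v with orient⁻ k edge u v e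
  ... | inj₁ e′ = e′
  ... | inj₂ e′ = ⊥-elim (<-asym u<v (≤-reflexive (sym (edge-level e′))))

  -- No step gains more than one level, even when undirected edges allow going down, so the level
  -- difference bounds the length from below.
  walk-level : ∀ {F u x} q → Walk network F u x (u ∷ q) → lev x ≤ lev u + length q
  walk-level []      (walk _ refl _) = ≤-reflexive (sym (+-identityʳ _))
  walk-level {F} {u} {x} (v ∷ q) (walk _ e (a , _ , st)) = begin
    lev x                    ≤⟨ walk-level q (walk refl e st) ⟩
    lev v + length q         ≤⟨ +-monoˡ-≤ (length q) (adj-lev u v a) ⟩
    suc (lev u) + length q   ≡⟨ sym (+-suc (lev u) (length q)) ⟩
    lev u + suc (length q)   ∎
    where open ≤-Reasoning

  module Faulty (C : ℕ → ℕ → Bool) (C⊆edge : ∀ u v → C u v ≡ true → edge u v ≡ true)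
                (x : Fin n) (β≤x : β ≤ toℕ x) where

    F : BRel n
    F = orient k C

    faults-valid : ValidF network F
    faults-valid = orient-⊆ k C⊆edge , orient-symm k C

    uncut : ∀ u v → edge (toℕ u) (toℕ v) ≡ true → C (toℕ u) (toℕ v) ≡ false → F u v ≡ false
    uncut u v e c = ¬true λ f → contra (orient⁻ k C u v f)
      where
      contra : ¬ (C (toℕ u) (toℕ v) ≡ true ⊎ C (toℕ v) (toℕ u) ≡ true)
      contra (inj₁ c′) with () ← trans (sym c) c′
      contra (inj₂ c′) = <-asym (edge-< e) (edge-< (C⊆edge _ _ c′))

    uncut⁻ : ∀ u v → F u v ≡ false → C (toℕ u) (toℕ v) ≡ false
    uncut⁻ u v f = ¬true λ c → case trans (sym f) (orient⁺ k C u v c) of λ ()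

    -- Here `d` is the remaining depth and `z` the number of the leaf to be passed. Competitors
    -- within the length bound are compared by tie alone, and strictly, so that the selected walk
    -- can be identified with this one.
    record Optimal (u : Fin n) (d z : ℕ) : Set where
      field
        tail       : List (Fin n)
        isWalk     : Walk network F u x (u ∷ tail)
        tailLength : length tail ≡ suc d
        increasing : Increasing (u ∷ tail)
        lastEdge   : Σ (Fin n) λ w → toℕ w ≡ z × Consec w x (u ∷ tail)
        optimal    : ∀ q → Walk network F u x (u ∷ q) → length q ≤ suc d → q ≡ tail ⊎ tie (u ∷ tail) < tie (u ∷ q)
    open Optimal

    -- There is no slack: a walk that short has to go up one level in every step.
    tight-step : ∀ {u v q d} → lev u + suc d ≡ D → Walk network F u x (u ∷ v ∷ q) → length q ≤ suc d →
      edge (toℕ u) (toℕ v) ≡ true × C (toℕ u) (toℕ v) ≡ false × Walk network F v x (v ∷ q)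
    tight-step {u} {v} {q} {d} l+d≡D (walk _ e (a , f , st)) |q|≤ =
      adj-up u v a up , uncut⁻ u v f , walk refl e st
      where
      open ≤-Reasoning
      up : lev u < lev v
      up = +-cancelʳ-≤ (suc d) _ _ (begin
        suc (lev u) + suc d    ≡⟨ cong suc l+d≡D ⟩
        suc D                  ≡⟨ sym (sink-level β≤x) ⟩
        lev x                  ≤⟨ walk-level q (walk refl e st) ⟩
        lev v + length q       ≤⟨ +-monoʳ-≤ (lev v) |q|≤ ⟩
        lev v + suc d          ∎)

    -- A competitor either starts towards a smaller successor and loses at that edge, or shares the
    -- first edge and is compared by `opt`.
    extend : ∀ {u v d z} → toℕ u < β → lev u + suc d ≡ D →
      edge (toℕ u) (toℕ v) ≡ true → C (toℕ u) (toℕ v) ≡ false →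
      (∀ v′ → edge (toℕ u) (toℕ v′) ≡ true → C (toℕ u) (toℕ v′) ≡ false → v′ ≡ v ⊎ v′ Fin.< v) →
      Optimal v d z → Optimal u (suc d) z
    extend {u} {v} {d} {z} u<β l+d≡D e c choice opt = record
      { tail       = v ∷ tail opt
      ; isWalk     = let walk _ en st = isWalk opt in walk refl en (orient⁺ k edge u v e , uncut u v e c , st)
      ; tailLength = cong suc (tailLength opt)
      ; increasing = inc
      ; lastEdge   = let w , eq , on = lastEdge opt in w , eq , Consec-∷ on
      ; optimal    = best
      }
      where
      inc : Increasing (u ∷ v ∷ tail opt)
      inc = edge-< e ∷ increasing opt
      best : ∀ q → Walk network F u x (u ∷ q) → length q ≤ suc (suc d) →
        q ≡ v ∷ tail opt ⊎ tie (u ∷ v ∷ tail opt) < tie (u ∷ q)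
      best []       (walk _ refl _) _ = ⊥-elim (<⇒≱ u<β β≤x)
      best (v′ ∷ q) w (s≤s |q|≤) with tight-step l+d≡D w |q|≤
      ... | e′ , c′ , w′ with choice v′ e′ c′
      ...   | inj₂ v′<v = inj₂ (tie-larger-child {p′ = q} inc v′<v)
      ...   | inj₁ refl with optimal opt q w′ |q|≤
      ...     | inj₁ refl = inj₁ refl
      ...     | inj₂ lt   = inj₂ (+-monoʳ-< (weight u v) lt)

    vertex : ∀ {m} → m < β → Σ (Fin n) λ v → toℕ v ≡ m
    vertex m<β = fromℕ< m<n , toℕ-fromℕ< m<n
      where m<n = <-trans m<β (≤-<-trans β≤x (toℕ<n x))

    -- At a left turn the edge to the right is cut and the left child is the only choice; at a right
    -- turn the left child stays available, but it has the smaller number.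
    leaf-optimal : ∀ {d} {t : Tree d} (ℓ : Leaf t) {o l u} → toℕ u ≡ o → Rooted t o l → Fits C ℓ o →
      l + d ≡ D → o + nodes t ≤ β → Optimal u d (pos ℓ o)
    leaf-optimal here {o} {l} {u} refl eq fits l+d≡D bnd = record
      { tail       = x ∷ []
      ; isWalk     = walk refl refl (orient⁺ k edge u x e , uncut u x e (fits (toℕ x)) , tt)
      ; tailLength = refl
      ; increasing = edge-< e ∷ [-]
      ; lastEdge   = u , refl , [] , [] , refl
      ; optimal    = best
      }
      where
      e : edge (toℕ u) (toℕ x) ≡ true
      e = trans (edge≡ eq (toℕ x)) (≤ᵇ-true β≤x)
      best : ∀ q → Walk network F u x (u ∷ q) → length q ≤ 1 → q ≡ x ∷ [] ⊎ tie (u ∷ x ∷ []) < tie (u ∷ q)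
      best []           (walk _ refl _) _ = ⊥-elim (<-irrefl refl (edge-< e))
      best (y ∷ [])     (walk _ refl _) _ = inj₁ refl
      best (_ ∷ _ ∷ _)  _ (s≤s ())
    leaf-optimal (down {t = t} ℓ) {o} {l} {u} refl (eq , rt) (c , fits) l+d≡D bnd =
      let bnd′ = subst (_≤ β) (+-suc o (nodes t)) bnd
          v , v≡ = vertex (<-≤-trans (s≤s (m<m+n o (nodes>0 t))) bnd′)
      in extend (<-≤-trans (m<m+n o z<s) bnd) (trans (cong (_+ _) (cong proj₁ eq)) l+d≡D)
           (trans (edge≡ eq (toℕ v)) (trans (cong (_≡ᵇ suc o) v≡) (≡ᵇ-true (suc o))))
           (trans (cong (C o) v≡) c)
           (λ v′ e _ → inj₁ (toℕ-injective (trans (≡ᵇ-true⁻ (trans (sym (edge≡ eq (toℕ v′))) e)) (sym v≡))))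
           (leaf-optimal ℓ v≡ rt fits (trans (sym (+-suc l _)) l+d≡D) bnd′)
    leaf-optimal (left {l = a} {r = b} ℓ) {o} {l} {u} refl (eq , ra , rb) (c , c′ , fits) l+d≡D bnd =
      let bnd′ = ≤-trans (s≤s (+-monoʳ-≤ o (m≤m+n (nodes a) (nodes b)))) (subst (_≤ β) (+-suc o (nodes a + nodes b)) bnd)
          v , v≡ = vertex (<-≤-trans (s≤s (m<m+n o (nodes>0 a))) bnd′)
      in extend (<-≤-trans (m<m+n o z<s) bnd) (trans (cong (_+ _) (cong proj₁ eq)) l+d≡D)
           (trans (edge≡ eq (toℕ v)) (∨-true⁺ˡ (trans (cong (_≡ᵇ suc o) v≡) (≡ᵇ-true (suc o)))))
           (trans (cong (C o) v≡) c)
           (λ v′ e c″ → inj₁ (toℕ-injective (trans (pick v′ e c″) (sym v≡))))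
           (leaf-optimal ℓ v≡ ra fits (trans (sym (+-suc l _)) l+d≡D) bnd′)
      where
      pick : ∀ v′ → edge o (toℕ v′) ≡ true → C o (toℕ v′) ≡ false → toℕ v′ ≡ suc o
      pick v′ e c″ with ∨-true⁻ {toℕ v′ ≡ᵇ suc o} (trans (sym (edge≡ eq (toℕ v′))) e)
      ... | inj₁ h = ≡ᵇ-true⁻ h
      ... | inj₂ h with () ← trans (sym c″) (trans (cong (C o) (≡ᵇ-true⁻ {toℕ v′} h)) c′)
    leaf-optimal (right {l = a} {r = b} ℓ) {o} {l} {u} refl (eq , ra , rb) (c , fits) l+d≡D bnd =
      let bnd′ = subst (_≤ β) (trans (+-suc o (nodes a + nodes b)) (cong suc (sym (+-assoc o (nodes a) (nodes b))))) bnd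
          v , v≡ = vertex (<-≤-trans (m<m+n (suc o + nodes a) (nodes>0 b)) bnd′)
      in extend (<-≤-trans (m<m+n o z<s) bnd) (trans (cong (_+ _) (cong proj₁ eq)) l+d≡D)
           (trans (edge≡ eq (toℕ v)) (∨-true⁺ʳ (trans (cong (_≡ᵇ suc o + nodes a) v≡) (≡ᵇ-true (suc o + nodes a)))))
           (trans (cong (C o) v≡) c)
           (λ v′ e _ → pick v v≡ v′ e)
           (leaf-optimal ℓ v≡ rb fits (trans (sym (+-suc l _)) l+d≡D) bnd′)
      where
      pick : ∀ v → toℕ v ≡ suc o + nodes a → ∀ v′ → edge o (toℕ v′) ≡ true → v′ ≡ v ⊎ v′ Fin.< v
      pick v v≡ v′ e with ∨-true⁻ {toℕ v′ ≡ᵇ suc o} (trans (sym (edge≡ eq (toℕ v′))) e)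
      ... | inj₁ h = inj₂ (subst₂ _<_ (sym (≡ᵇ-true⁻ h)) (sym v≡) (m<m+n (suc o) (nodes>0 a)))
      ... | inj₂ h = inj₁ (toℕ-injective (trans (≡ᵇ-true⁻ h) (sym v≡)))

    -- The selected walk costs no more than the constructed one, hence is no longer and falls under
    -- `optimal`. By the levels it is no shorter either, so a larger tie would contradict its being
    -- cheapest.
    leaf-edge-selected : ∀ {d} {t : Tree d} (ℓ : Leaf t) {o s} → toℕ s ≡ o → Rooted t o 0 → Fits C ℓ o →
      d ≡ D → o + nodes t ≤ β → Σ (Fin n) λ w → toℕ w ≡ pos ℓ o × OnM k w x (scheme network s x F)
    leaf-edge-selected {t = t} ℓ {o} {s} refl rt fits refl bnd
      with opt ← leaf-optimal ℓ {u = s} refl rt fits refl bnd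
      with scheme network s x F | selected network F s x
    ... | nothing | none = ⊥-elim (none _ (isWalk opt))
    ... | just q | (w , least) with head-tail q (Walk.starts w)
    ...   | q′ , refl = let z , z≡ , on = lastEdge opt
                    in z , z≡ , onPath k (subst (λ r → Consec z x (s ∷ r)) (sym (same q′ w least)) on)
      where
      onPath : ∀ k {u v : Fin n} {p} → Consec u v p → OnPath k u v p
      onPath directed   c = c
      onPath undirected c = inj₁ c
      same : ∀ q → Walk network F s x (s ∷ q) → (∀ p → Walk network F s x p → cost (s ∷ q) ≤ cost p) → q ≡ tail opt
      same q w least with optimal opt q w (subst (length q ≤_) (tailLength opt) (≤-pred
          (cost≤⇒length≤ (s ∷ q) (s ∷ tail opt) (increasing⇒Unique (increasing opt)) (least _ (isWalk opt)))))
      ... | inj₁ eq = eq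
      ... | inj₂ lt = ⊥-elim (<⇒≱ (cost-mono {p = s ∷ tail opt} {q = s ∷ q} (s≤s longer) lt) (least _ (isWalk opt)))
        where
        open ≤-Reasoning
        longer : length (tail opt) ≤ length q
        longer = begin
          length (tail opt)     ≡⟨ tailLength opt ⟩
          suc D                 ≡⟨ sym (sink-level β≤x) ⟩
          lev x                 ≤⟨ walk-level q w ⟩
          lev s + length q      ≡⟨ cong (_+ length q) (rooted-level t rt) ⟩
          length q              ∎

-- The faults that force a leaf

cuts : ∀ {d} {t : Tree d} → Leaf t → ℕ → List (ℕ × ℕ)
cuts here              o = []
cuts (down ℓ)          o = cuts ℓ (suc o)
cuts (left {l = l} ℓ)  o = (o , suc o + nodes l) ∷ cuts ℓ (suc o)
cuts (right {l = l} ℓ) o = cuts ℓ (suc o + nodes l)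

isCut : List (ℕ × ℕ) → ℕ → ℕ → Bool
isCut cs u v = ⌊ (u , v) ∈? cs ⌋

isCut⁻ : ∀ {cs u v} → isCut cs u v ≡ true → (u , v) ∈ cs
isCut⁻ {cs} {u} {v} e with (u , v) ∈? cs
... | yes i = i

isCut-true : ∀ {cs u v} → (u , v) ∈ cs → isCut cs u v ≡ true
isCut-true {cs} {u} {v} i with (u , v) ∈? cs
... | yes _ = refl
... | no ¬i = ⊥-elim (¬i i)

isCut-false : ∀ {cs u v} → ¬ (u , v) ∈ cs → isCut cs u v ≡ false
isCut-false {cs} {u} {v} ¬i with (u , v) ∈? cs
... | yes i = ⊥-elim (¬i i)
... | no _  = refl

-- Keeps the cuts made inside a subtree away from the edges that leave its ancestors.
cuts-source : ∀ {d} {t : Tree d} (ℓ : Leaf t) {o u v} → (u , v) ∈ cuts ℓ o → o ≤ u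
cuts-source (down ℓ)          i           = <⇒≤ (cuts-source ℓ i)
cuts-source (left ℓ)          (here refl) = ≤-refl
cuts-source (left ℓ)          (there i)   = <⇒≤ (cuts-source ℓ i)
cuts-source (right {l = l} ℓ) {o} i       = ≤-trans (≤-trans (n≤1+n o) (m≤m+n (suc o) (nodes l))) (cuts-source ℓ i)

module _ (node : ℕ → Node) (β D : ℕ) where

  open Layered node β D

  cuts-edge : ∀ {d} {t : Tree d} (ℓ : Leaf t) {o l u v} → Rooted t o l → (u , v) ∈ cuts ℓ o → edge u v ≡ true
  cuts-edge (down ℓ)          (_ , rt)           i           = cuts-edge ℓ rt i
  cuts-edge (left {l = a} ℓ) {o} (eq , ra , _)  (here refl) =
    trans (edge≡ eq (suc o + nodes a)) (∨-true⁺ʳ (≡ᵇ-true (suc o + nodes a)))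
  cuts-edge (left ℓ)          (_ , ra , _)       (there i)   = cuts-edge ℓ ra i
  cuts-edge (right ℓ)         (_ , _ , rb)       i           = cuts-edge ℓ rb i

  -- The full list `cs` stays fixed on the way down; the two hypotheses say that, among sources from
  -- `o` on, it agrees with the cuts still to come.
  cuts-fit : ∀ cs {d} {t : Tree d} (ℓ : Leaf t) o → (∀ {u v} → o ≤ u → (u , v) ∈ cs → (u , v) ∈ cuts ℓ o) →
    (∀ {u v} → (u , v) ∈ cuts ℓ o → (u , v) ∈ cs) → Fits (isCut cs) ℓ o
  cuts-fit cs here     o to from = λ v → isCut-false λ i → case to ≤-refl i of λ ()
  cuts-fit cs (down ℓ) o to from =
    isCut-false (λ i → <-irrefl refl (cuts-source ℓ (to ≤-refl i))) , cuts-fit cs ℓ (suc o) (to ∘ <⇒≤) from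
  cuts-fit cs (left {l = a} {r = b} ℓ) o to from =
    isCut-false (λ i → excluded (to ≤-refl i)) , isCut-true (from (here refl)) ,
    cuts-fit cs ℓ (suc o) (λ o<u i → deeper o<u (to (<⇒≤ o<u) i)) (from ∘ there)
    where
    excluded : ¬ (o , suc o) ∈ cuts (left {l = a} {r = b} ℓ) o
    excluded (here e)  = <⇒≢ (m<m+n (suc o) (nodes>0 a)) (cong proj₂ e)
    excluded (there i) = <-irrefl refl (cuts-source ℓ i)
    deeper : ∀ {u v} → o < u → (u , v) ∈ cuts (left {l = a} {r = b} ℓ) o → (u , v) ∈ cuts ℓ (suc o)
    deeper o<u (here e)  = ⊥-elim (<⇒≢ o<u (sym (cong proj₁ e)))
    deeper o<u (there i) = i
  cuts-fit cs (right {l = a} ℓ) o to from =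
    isCut-false (λ i → <⇒≱ (s≤s (m≤m+n o (nodes a))) (cuts-source ℓ (to ≤-refl i))) ,
    cuts-fit cs ℓ (suc o + nodes a) (λ le → to (≤-trans (n≤1+n o) (≤-trans (m≤m+n (suc o) (nodes a)) le))) from

-- Counting faults

∑ : ∀ {n} → (Fin n → ℕ) → List (Fin n) → ℕ
∑ f xs = sum (map f xs)

∑-mono : ∀ {n} {f g : Fin n → ℕ} → (∀ u → f u ≤ g u) → ∀ xs → ∑ f xs ≤ ∑ g xs
∑-mono h []       = z≤n
∑-mono h (x ∷ xs) = +-mono-≤ (h x) (∑-mono h xs)

∑-+ : ∀ {n} (f g : Fin n → ℕ) xs → ∑ (λ u → f u + g u) xs ≡ ∑ f xs + ∑ g xs
∑-+ f g []       = refl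
∑-+ f g (x ∷ xs) = trans (cong (f x + g x +_) (∑-+ f g xs)) (interchange +-commutativeSemigroup (f x) (g x) (∑ f xs) (∑ g xs))

∑-*ˡ : ∀ {n} c (f : Fin n → ℕ) xs → ∑ (λ u → c * f u) xs ≡ c * ∑ f xs
∑-*ˡ c f []       = sym (*-zeroʳ c)
∑-*ˡ c f (x ∷ xs) = trans (cong (c * f x +_) (∑-*ˡ c f xs)) (sym (*-distribˡ-+ c (f x) _))

δ : ℕ → ℕ → ℕ
δ a b = if ⌊ a ℕ.≟ b ⌋ then 1 else 0

∑-δ : ∀ {n} a {xs : List (Fin n)} → Unique xs → ∑ (δ a ∘ toℕ) xs ≤ 1
∑-δ a []             = z≤n
∑-δ a {x ∷ xs} (x∉ ∷ u) with a ℕ.≟ toℕ x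
... | no _     = ∑-δ a u
... | yes refl = ≤-reflexive (cong suc (absent x∉))
  where
  absent : ∀ {ys} → All (x ≢_) ys → ∑ (δ (toℕ x) ∘ toℕ) ys ≡ 0
  absent []          = refl
  absent {y ∷ _} (x≢y ∷ x∉) with toℕ x ℕ.≟ toℕ y
  ... | yes e = ⊥-elim (x≢y (toℕ-injective e))
  ... | no _  = absent x∉

-- An additive upper bound for the indicator of `isCut`: its double sum splits over the list, and
-- each product of two `δ` contributes at most 1.
multiplicity : List (ℕ × ℕ) → ℕ → ℕ → ℕ
multiplicity []             u v = 0
multiplicity ((a , b) ∷ cs) u v = δ a u * δ b v + multiplicity cs u v

∈⇒multiplicity : ∀ {cs u v} → (u , v) ∈ cs → 1 ≤ multiplicity cs u v
∈⇒multiplicity {_} {u} {v} (here refl) with u ℕ.≟ u | v ℕ.≟ v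
... | yes _ | yes _ = s≤s z≤n
... | no ¬e | _     = ⊥-elim (¬e refl)
... | yes _ | no ¬e = ⊥-elim (¬e refl)
∈⇒multiplicity (there i) = ≤-trans (∈⇒multiplicity i) (m≤n+m _ _)

∑∑-multiplicity : ∀ {n} cs {xs ys : List (Fin n)} → Unique xs → Unique ys →
  ∑ (λ u → ∑ (λ v → multiplicity cs (toℕ u) (toℕ v)) ys) xs ≤ length cs
∑∑-multiplicity []             {xs} {ys} _  _  =
  ≤-reflexive (trans (cong sum (map-cong (λ _ → zero-sum ys) xs)) (zero-sum xs))
  where
  zero-sum : ∀ {n} (zs : List (Fin n)) → ∑ (λ _ → 0) zs ≡ 0
  zero-sum []       = refl
  zero-sum (_ ∷ zs) = zero-sum zs
∑∑-multiplicity ((a , b) ∷ cs) {xs} {ys} ux uy = begin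
  ∑ (λ u → ∑ (λ v → δ a (toℕ u) * δ b (toℕ v) + multiplicity cs (toℕ u) (toℕ v)) ys) xs
    ≤⟨ ∑-mono (λ u → ≤-reflexive (trans (∑-+ (λ v → δ a (toℕ u) * δ b (toℕ v)) _ ys)
         (cong (_+ ∑ (λ v → multiplicity cs (toℕ u) (toℕ v)) ys) (∑-*ˡ (δ a (toℕ u)) (δ b ∘ toℕ) ys)))) xs ⟩
  ∑ (λ u → δ a (toℕ u) * ∑ (δ b ∘ toℕ) ys + ∑ (λ v → multiplicity cs (toℕ u) (toℕ v)) ys) xs
    ≤⟨ ∑-mono (λ u → +-monoˡ-≤ _ (≤-trans (*-monoʳ-≤ (δ a (toℕ u)) (∑-δ b uy)) (≤-reflexive (*-identityʳ _)))) xs ⟩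
  ∑ (λ u → δ a (toℕ u) + ∑ (λ v → multiplicity cs (toℕ u) (toℕ v)) ys) xs
    ≡⟨ ∑-+ (δ a ∘ toℕ) _ xs ⟩
  ∑ (δ a ∘ toℕ) xs + ∑ (λ u → ∑ (λ v → multiplicity cs (toℕ u) (toℕ v)) ys) xs
    ≤⟨ +-mono-≤ (∑-δ a ux) (∑∑-multiplicity cs ux uy) ⟩
  suc (length cs) ∎
  where open ≤-Reasoning

-- Cuts increase, as canonical pairs do, so in the undirected case the reversed copy of a cut is
-- never counted.
size-isCut : ∀ k n cs → (∀ {u v} → (u , v) ∈ cs → u < v) → size k {n} (orient k (isCut cs)) ≤ length cs
size-isCut k n cs up = ≤-trans (∑-mono (λ u → ∑-mono (indicator k u) (allFin n)) (allFin n))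
  (∑∑-multiplicity cs (Unique.allFin⁺ n) (Unique.allFin⁺ n))
  where
  indicator : ∀ k (u v : Fin n) →
    (if orient k (isCut cs) u v ∧ canon k u v then 1 else 0) ≤ multiplicity cs (toℕ u) (toℕ v)
  indicator directed   u v with (toℕ u , toℕ v) ∈? cs
  ... | yes i = ∈⇒multiplicity i
  ... | no _  = z≤n
  indicator undirected u v with (toℕ u , toℕ v) ∈? cs | (toℕ v , toℕ u) ∈? cs | toℕ u <ᵇ toℕ v in eq
  ... | yes i | _     | true  = ∈⇒multiplicity i
  ... | no _  | yes i | true  = ⊥-elim (<-asym (up i) (<ᵇ⇒< _ _ (subst T (sym eq) tt)))
  ... | no _  | no _  | _     = z≤n
  ... | yes _ | _     | false = z≤n
  ... | no _  | yes _ | false = z≤n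

-- Numbers of leaves and tables of nodes

leaves : ∀ {d} → Tree d → ℕ
leaves leaf      = 1
leaves (un t)    = leaves t
leaves (bin l r) = leaves l + leaves r

positions : ∀ {d} → Tree d → ℕ → List ℕ
positions leaf      o = o ∷ []
positions (un t)    o = positions t (suc o)
positions (bin l r) o = positions l (suc o) ++ positions r (suc o + nodes l)

positions-length : ∀ {d} (t : Tree d) o → length (positions t o) ≡ leaves t
positions-length leaf      o = refl
positions-length (un t)    o = positions-length t (suc o)
positions-length (bin l r) o = trans (length-++ (positions l (suc o)))
  (cong₂ _+_ (positions-length l (suc o)) (positions-length r (suc o + nodes l)))

Within : ℕ → ℕ → ℕ → Set
Within a b p = a ≤ p × p < b

widen : ∀ {a a′ b b′} {ps} → a′ ≤ a → b ≤ b′ → All (Within a b) ps → All (Within a′ b′) ps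
widen a′≤a b≤b′ = All.map λ (a≤p , p<b) → ≤-trans a′≤a a≤p , <-≤-trans p<b b≤b′

within-disjoint : ∀ {a b c ps qs} → All (Within a b) ps → All (Within b c) qs → Disjoint ps qs
within-disjoint hp hq (p∈ , q∈) = <⇒≱ (proj₂ (All.lookup hp p∈)) (proj₁ (All.lookup hq q∈))

positions-within : ∀ {d} (t : Tree d) o → All (Within o (o + nodes t)) (positions t o)
positions-within leaf      o = (≤-refl , m<m+n o z<s) ∷ []
positions-within (un t)    o = widen (n≤1+n o) (≤-reflexive (sym (+-suc o (nodes t)))) (positions-within t (suc o))
positions-within (bin l r) o = All.++⁺
  (widen (n≤1+n o) (≤-trans (s≤s (+-monoʳ-≤ o (m≤m+n (nodes l) (nodes r)))) (≤-reflexive (sym (+-suc o _))))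
    (positions-within l (suc o)))
  (widen (≤-trans (n≤1+n o) (m≤m+n (suc o) (nodes l)))
    (≤-reflexive (trans (+-assoc (suc o) (nodes l) (nodes r)) (sym (+-suc o _))))
    (positions-within r (suc o + nodes l)))

positions-Unique : ∀ {d} (t : Tree d) o → Unique (positions t o)
positions-Unique leaf      o = [] ∷ []
positions-Unique (un t)    o = positions-Unique t (suc o)
positions-Unique (bin l r) o = Unique.++⁺ (positions-Unique l (suc o)) (positions-Unique r (suc o + nodes l))
  (within-disjoint (positions-within l (suc o)) (positions-within r (suc o + nodes l)))

∈-positions : ∀ {d} (t : Tree d) {o p} → p ∈ positions t o → Σ (Leaf t) λ ℓ → pos ℓ o ≡ p
∈-positions leaf      (here refl) = here , refl
∈-positions (un t)    i = let ℓ , e = ∈-positions t i in down ℓ , e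
∈-positions (bin l r) {o} i with ∈-++⁻ (positions l (suc o)) i
... | inj₁ i′ = let ℓ , e = ∈-positions l i′ in left ℓ , e
... | inj₂ i′ = let ℓ , e = ∈-positions r i′ in right ℓ , e

-- The default `z` is the value at every number beyond the table; later it is `sink`.
look : Node → List Node → ℕ → Node
look z []       _       = z
look z (x ∷ xs) zero    = x
look z (x ∷ xs) (suc i) = look z xs i

look-++ˡ : ∀ z xs ys {i} → i < length xs → look z (xs ++ ys) i ≡ look z xs i
look-++ˡ z (x ∷ xs) ys {zero}  _         = refl
look-++ˡ z (x ∷ xs) ys {suc i} (s≤s i<) = look-++ˡ z xs ys i<

look-++ʳ : ∀ z xs ys i → look z (xs ++ ys) (length xs + i) ≡ look z ys i
look-++ʳ z []       ys i = refl
look-++ʳ z (x ∷ xs) ys i = look-++ʳ z xs ys i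

look-beyond : ∀ z xs {i} → length xs ≤ i → look z xs i ≡ z
look-beyond z []       _        = refl
look-beyond z (x ∷ xs) (s≤s le) = look-beyond z xs le

table : ℕ → ∀ {d} → Tree d → ℕ → ℕ → List Node
table β leaf      o l = (l , (β ≤ᵇ_)) ∷ []
table β (un t)    o l = (l , unary o) ∷ table β t (suc o) (suc l)
table β (bin a b) o l = (l , binary o (nodes a)) ∷ table β a (suc o) (suc l) ++ table β b (suc o + nodes a) (suc l)

table-length : ∀ β {d} (t : Tree d) o l → length (table β t o l) ≡ nodes t
table-length β leaf      o l = refl
table-length β (un t)    o l = cong suc (table-length β t (suc o) (suc l))
table-length β (bin a b) o l = cong suc (trans (length-++ (table β a (suc o) (suc l)))
  (cong₂ _+_ (table-length β a (suc o) (suc l)) (table-length β b (suc o + nodes a) (suc l))))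

module _ (node : ℕ → Node) (β D : ℕ) (z : Node) where

  open Layered node β D

  table-rooted : ∀ {d} (t : Tree d) o l → (∀ i → i < nodes t → node (o + i) ≡ look z (table β t o l) i) → Rooted t o l
  table-rooted leaf o l h = trans (cong node (sym (+-identityʳ o))) (h 0 z<s)
  table-rooted (un t) o l h = trans (cong node (sym (+-identityʳ o))) (h 0 z<s) ,
    table-rooted t (suc o) (suc l) λ i i< → trans (cong node (sym (+-suc o i))) (h (suc i) (s≤s i<))
  table-rooted (bin a b) o l h = trans (cong node (sym (+-identityʳ o))) (h 0 z<s) ,
    table-rooted a (suc o) (suc l) (λ i i< → trans (cong node (sym (+-suc o i)))
      (trans (h (suc i) (s≤s (<-≤-trans i< (m≤m+n (nodes a) (nodes b)))))
        (look-++ˡ z ta tb (subst (i <_) (sym (table-length β a (suc o) (suc l))) i<)))) ,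
    table-rooted b (suc o + nodes a) (suc l) (λ i i< → trans (cong node (trans (+-assoc (suc o) (nodes a) i) (sym (+-suc o _))))
      (trans (h (suc (nodes a + i)) (s≤s (+-monoʳ-< (nodes a) i<)))
        (trans (cong (λ m → look z (ta ++ tb) (m + i)) (sym (table-length β a (suc o) (suc l)))) (look-++ʳ z ta tb i))))
    where
    ta = table β a (suc o) (suc l)
    tb = table β b (suc o + nodes a) (suc l)

-- The recursive trees and their sizes

chain : ∀ i {d} → Tree d → Tree (i + d)
chain zero    t = t
chain (suc i) t = un (chain i t)

-- i + 1 copies of t hang off a path; the connecting chains put all leaves at the same depth.
spine : ∀ i {d} → Tree d → Tree (i + d)
spine zero    t = t
spine (suc i) t = bin (chain i t) (spine i t)

nodes-chain : ∀ i {d} (t : Tree d) → nodes (chain i t) ≡ i + nodes t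
nodes-chain zero    t = refl
nodes-chain (suc i) t = cong suc (nodes-chain i t)

leaves-chain : ∀ i {d} (t : Tree d) → leaves (chain i t) ≡ leaves t
leaves-chain zero    t = refl
leaves-chain (suc i) t = leaves-chain i t

leaves-spine : ∀ i {d} (t : Tree d) → leaves (spine i t) ≡ suc i * leaves t
leaves-spine zero    t = sym (+-identityʳ _)
leaves-spine (suc i) t = cong₂ _+_ (leaves-chain i t) (leaves-spine i t)

-- The `i` branching nodes and the chains of lengths 0 to `i - 1` add up to `i (i + 1) / 2`
-- connecting nodes. This is of the order of the copies themselves once `t` has about `i` nodes.
nodes-spine : ∀ i {d} (t : Tree d) → nodes (spine i t) ≤ suc i * nodes t + i * i
nodes-spine zero    t = ≤-reflexive (trans (sym (+-identityʳ _)) (sym (+-identityʳ _)))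
nodes-spine (suc i) t = begin
  suc (nodes (chain i t) + nodes (spine i t))
    ≤⟨ s≤s (+-mono-≤ (≤-reflexive (nodes-chain i t)) (nodes-spine i t)) ⟩
  suc (i + s + (suc i * s + i * i))
    ≡⟨ solve 2 (λ i s → con 1 :+ (i :+ s :+ ((con 1 :+ i) :* s :+ i :* i)) := (con 2 :+ i) :* s :+ (con 1 :+ i :+ i :* i)) refl i s ⟩
  suc (suc i) * s + (suc i + i * i)
    ≤⟨ +-monoʳ-≤ (suc (suc i) * s) (+-monoʳ-≤ (suc i) (*-monoʳ-≤ i (n≤1+n i))) ⟩
  suc (suc i) * s + suc i * suc i                          ∎
  where
  open ≤-Reasoning
  s = nodes t

CutBound : ℕ → ∀ {d} → Tree d → Set
CutBound f t = ∀ (ℓ : Leaf t) o → length (cuts ℓ o) ≤ f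

cutBound-chain : ∀ {f} i {d} {t : Tree d} → CutBound f t → CutBound f (chain i t)
cutBound-chain zero    h ℓ        o = h ℓ o
cutBound-chain (suc i) h (down ℓ) o = cutBound-chain i h ℓ (suc o)

-- The path is left by at most one left turn, and a chain has no turns at all.
cutBound-spine : ∀ {f} i {d} {t : Tree d} → CutBound f t → CutBound (suc f) (spine i t)
cutBound-spine zero    h ℓ         o = m≤n⇒m≤1+n (h ℓ o)
cutBound-spine (suc i) h (left ℓ)  o = s≤s (cutBound-chain i h ℓ (suc o))
cutBound-spine (suc i) h (right ℓ) o = cutBound-spine i h ℓ _

depth : ℕ → ℕ → ℕ
depth zero    b = 0
depth (suc f) b = b ^ (2 ^ f) + depth f b

tree : ∀ f b → Tree (depth f b)
tree zero    b = leaf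
tree (suc f) b = spine (b ^ (2 ^ f)) (tree f b)

tree-cutBound : ∀ f b → CutBound f (tree f b)
tree-cutBound zero    b here o = z≤n
tree-cutBound (suc f) b = cutBound-spine (b ^ (2 ^ f)) (tree-cutBound f b)

-- Equal to `2 ^ suc f - 1`. In each step the 2 absorbs `suc x ≤ x + x` for the number of copies,
-- the 1 the connecting nodes.
ratio : ℕ → ℕ
ratio zero    = 1
ratio (suc f) = suc (2 * ratio f)

double : ∀ b f → b ^ (2 ^ suc f) ≡ b ^ (2 ^ f) * b ^ (2 ^ f)
double b f = trans (cong (λ e → b ^ (2 ^ f + e)) (+-identityʳ (2 ^ f))) (^-distribˡ-+-* b (2 ^ f) (2 ^ f))

tree-size : ∀ f b → 1 ≤ b → nodes (tree f b) ≤ ratio f * b ^ (2 ^ f)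
tree-size zero    b 1≤b = ≤-trans 1≤b (≤-reflexive (sym (trans (+-identityʳ _) (*-identityʳ b))))
tree-size (suc f) b 1≤b = begin
  nodes (spine x (tree f b))                      ≤⟨ nodes-spine x (tree f b) ⟩
  suc x * nodes (tree f b) + x * x                ≤⟨ +-monoˡ-≤ (x * x) (*-mono-≤ (+-monoˡ-≤ x 1≤x) (tree-size f b 1≤b)) ⟩
  (x + x) * (ratio f * x) + x * x
    ≡⟨ solve 2 (λ x r → (x :+ x) :* (r :* x) :+ x :* x := (con 1 :+ con 2 :* r) :* (x :* x)) refl x (ratio f) ⟩
  suc (2 * ratio f) * (x * x)                    ≡⟨ cong (suc (2 * ratio f) *_) (sym (double b f)) ⟩
  suc (2 * ratio f) * b ^ (2 ^ suc f)            ∎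
  where
  open ≤-Reasoning
  x = b ^ (2 ^ f)
  1≤x : 1 ≤ x
  1≤x = m^n>0 b {{>-nonZero 1≤b}} (2 ^ f)

tree-leaves : ∀ f b → b ^ (2 ^ f ∸ 1) ≤ leaves (tree f b)
tree-leaves zero    b = s≤s z≤n
tree-leaves (suc f) b = begin
  b ^ (2 ^ suc f ∸ 1)
    ≡⟨ cong (b ^_) (trans (cong (λ e → 2 ^ f + e ∸ 1) (+-identityʳ (2 ^ f))) (+-∸-assoc (2 ^ f) (m^n>0 2 f))) ⟩
  b ^ (2 ^ f + (2 ^ f ∸ 1))                ≡⟨ ^-distribˡ-+-* b (2 ^ f) (2 ^ f ∸ 1) ⟩
  b ^ (2 ^ f) * b ^ (2 ^ f ∸ 1)            ≤⟨ *-mono-≤ (n≤1+n (b ^ (2 ^ f))) (tree-leaves f b) ⟩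
  suc (b ^ (2 ^ f)) * leaves (tree f b)    ≡⟨ sym (leaves-spine (b ^ (2 ^ f)) (tree f b)) ⟩
  leaves (tree (suc f) b)                  ∎
  where open ≤-Reasoning

-- Arithmetic and conclusion

-- Replaces extracting a root: it provides a parameter `b` that `n` can just afford.
crossing : ∀ (g : ℕ → ℕ) {n} → g 1 ≤ n → ∀ j → n < g (suc j) → ∃ λ b → 1 ≤ b × g b ≤ n × n < g (suc b)
crossing g g1≤n zero    n<g1 = ⊥-elim (<⇒≱ n<g1 g1≤n)
crossing g {n} g1≤n (suc j) n<g with g (suc j) ≤? n
... | yes le = suc j , s≤s z≤n , le , n<g
... | no ¬le = crossing g g1≤n j (≰⇒> ¬le)

^-distribʳ-* : ∀ m n o → (m * n) ^ o ≡ m ^ o * n ^ o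
^-distribʳ-* m n zero    = refl
^-distribʳ-* m n (suc o) = trans (cong (m * n *_) (^-distribʳ-* m n o)) (interchange *-commutativeSemigroup m n (m ^ o) (n ^ o))

module _ (p c : ℕ) where

  -- The first 2 reserves half of the vertices for sinks, `c` is the size ratio of the tree, and
  -- `2 ^ suc p` pays for replacing `suc b` by `2 * b`.
  factor : ℕ
  factor = 2 * c * 2 ^ suc p

  fit : ∀ σ {n} → 1 ≤ c → 2 * (σ * c) ≤ n →
    ∃ λ b → 1 ≤ b × 2 * (σ * (c * b ^ suc p)) ≤ n × n * σ ≤ σ * factor * b ^ suc p * σ
  -- Without sources any `b` will do: the trailing factor `σ` of the last inequality is there to
  -- make it hold in this case too.
  fit zero    {n} _   _ = 1 , ≤-refl , z≤n , ≤-reflexive (*-zeroʳ n)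
  fit (suc τ) {n} 1≤c N≤n with crossing (λ b → 2 * (suc τ * (c * b ^ suc p))) first n last-step
    where
    open ≤-Reasoning
    first : 2 * (suc τ * (c * 1 ^ suc p)) ≤ n
    first = subst (λ x → 2 * (suc τ * x) ≤ n) (sym (trans (cong (c *_) (^-zeroˡ (suc p))) (*-identityʳ c))) N≤n
    last-step : n < 2 * (suc τ * (c * suc n ^ suc p))
    last-step = begin-strict
      n                                    <⟨ n<1+n n ⟩
      suc n                                ≤⟨ m≤m*n (suc n) (suc n ^ p) {{m^n≢0 (suc n) p}} ⟩
      suc n ^ suc p                        ≤⟨ m≤n*m (suc n ^ suc p) c {{>-nonZero 1≤c}} ⟩
      c * suc n ^ suc p                    ≤⟨ m≤n*m _ (suc τ) ⟩
      suc τ * (c * suc n ^ suc p)          ≤⟨ m≤n*m _ 2 ⟩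
      2 * (suc τ * (c * suc n ^ suc p))    ∎
  ... | b , 1≤b , le , lt = b , 1≤b , le , *-monoˡ-≤ (suc τ) (begin
    n                                                ≤⟨ <⇒≤ lt ⟩
    2 * (suc τ * (c * suc b ^ suc p))
      ≤⟨ *-monoʳ-≤ 2 (*-monoʳ-≤ (suc τ) (*-monoʳ-≤ c (^-monoˡ-≤ (suc p) 1+b≤2b))) ⟩
    2 * (suc τ * (c * (2 * b) ^ suc p))              ≡⟨ cong (λ x → 2 * (suc τ * (c * x))) (^-distribʳ-* 2 b (suc p)) ⟩
    2 * (suc τ * (c * (2 ^ suc p * b ^ suc p)))
      ≡⟨ solve 4 (λ s c x y → con 2 :* (s :* (c :* (x :* y))) := s :* (con 2 :* c :* x) :* y) refl (suc τ) c (2 ^ suc p) (b ^ suc p) ⟩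
    suc τ * factor * b ^ suc p                       ∎)
    where
    open ≤-Reasoning
    1+b≤2b : suc b ≤ 2 * b
    1+b≤2b = ≤-trans (+-monoˡ-≤ b 1≤b) (≤-reflexive (cong (b +_) (sym (+-identityʳ b))))

-- Of the `suc p + p` factors `n`, the last `p` are replaced by their bound. Since `(b ^ suc p) ^ p`
-- is `(b ^ p) ^ suc p`, enlarging the single `σ` to `σ * A` completes a power with exponent
-- `suc p`.
power-bound : ∀ p σ A b n → 1 ≤ A → n * σ ≤ σ * A * b ^ suc p * σ →
  n ^ (suc p + p) * σ ≤ (n * (σ * A * b ^ p)) ^ suc p
power-bound p zero    A b n _ _ = ≤-trans (≤-reflexive (*-zeroʳ (n ^ (suc p + p)))) z≤n
power-bound p σ@(suc _) A b n 1≤A n≤ = begin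
  n ^ (suc p + p) * σ                              ≡⟨ cong (_* σ) (^-distribˡ-+-* n (suc p) p) ⟩
  n ^ suc p * n ^ p * σ
    ≤⟨ *-monoˡ-≤ σ (*-monoʳ-≤ (n ^ suc p) (^-monoˡ-≤ p (*-cancelʳ-≤ n (σ * A * b ^ suc p) σ n≤))) ⟩
  n ^ suc p * (σ * A * b ^ suc p) ^ p * σ          ≡⟨ cong (λ x → n ^ suc p * x * σ) (^-distribʳ-* (σ * A) (b ^ suc p) p) ⟩
  n ^ suc p * ((σ * A) ^ p * (b ^ suc p) ^ p) * σ  ≡⟨ cong (λ x → n ^ suc p * ((σ * A) ^ p * x) * σ) exchange ⟩
  n ^ suc p * ((σ * A) ^ p * (b ^ p) ^ suc p) * σ
    ≤⟨ *-monoʳ-≤ (n ^ suc p * ((σ * A) ^ p * (b ^ p) ^ suc p)) (m≤m*n σ A {{>-nonZero 1≤A}}) ⟩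
  n ^ suc p * ((σ * A) ^ p * (b ^ p) ^ suc p) * (σ * A)
    ≡⟨ solve 4 (λ x y z w → x :* (y :* z) :* w := x :* (w :* y :* z)) refl (n ^ suc p) ((σ * A) ^ p) ((b ^ p) ^ suc p) (σ * A) ⟩
  n ^ suc p * ((σ * A) ^ suc p * (b ^ p) ^ suc p)  ≡⟨ cong (n ^ suc p *_) (sym (^-distribʳ-* (σ * A) (b ^ p) (suc p))) ⟩
  n ^ suc p * (σ * A * b ^ p) ^ suc p              ≡⟨ sym (^-distribʳ-* n _ (suc p)) ⟩
  (n * (σ * A * b ^ p)) ^ suc p                    ∎
  where
  open ≤-Reasoning
  exchange : (b ^ suc p) ^ p ≡ (b ^ p) ^ suc p
  exchange = trans (^-*-assoc b (suc p) p) (trans (cong (b ^_) (*-comm (suc p) p)) (sym (^-*-assoc b p (suc p))))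

-- The forest, its sources and its leaf edges

fromℕs : ∀ {n} xs → All (_< n) xs → Σ (List (Fin n)) λ ys → map toℕ ys ≡ xs
fromℕs []       []         = [] , refl
fromℕs (x ∷ xs) (x<n ∷ hs) = let ys , e = fromℕs xs hs in fromℕ< x<n ∷ ys , cong₂ _∷_ (toℕ-fromℕ< x<n) e

length-cartesianProduct : ∀ {A B : Set} (xs : List A) (ys : List B) → length (cartesianProduct xs ys) ≡ length xs * length ys
length-cartesianProduct []       ys = refl
length-cartesianProduct (x ∷ xs) ys = trans (length-++ (map (x ,_) ys))
  (cong₂ _+_ (length-map (x ,_) ys) (length-cartesianProduct xs ys))

module Forest {D} (t : Tree D) (σ : ℕ) where

  s β : ℕ
  s = nodes t
  β = σ * s

  sink : Node
  sink = suc D , λ _ → false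

  forest : ℕ → ℕ → List Node
  forest zero    o = []
  forest (suc m) o = table β t o 0 ++ forest m (o + s)

  forest-length : ∀ m o → length (forest m o) ≡ m * s
  forest-length zero    o = refl
  forest-length (suc m) o = trans (length-++ (table β t o 0)) (cong₂ _+_ (table-length β t o 0) (forest-length m (o + s)))

  forest-look : ∀ m o i j → i < m → j < s → look sink (forest m o) (i * s + j) ≡ look sink (table β t (o + i * s) 0) j
  forest-look (suc m) o zero    j _         j<s = trans
    (look-++ˡ sink (table β t o 0) _ (subst (j <_) (sym (table-length β t o 0)) j<s))
    (cong (λ o → look sink (table β t o 0) j) (sym (+-identityʳ o)))
  forest-look (suc m) o (suc i) j (s≤s i<m) j<s = begin
    look sink (forest (suc m) o) (s + i * s + j)
      ≡⟨ cong (look sink (forest (suc m) o)) (trans (+-assoc s (i * s) j) (cong (_+ (i * s + j)) (sym (table-length β t o 0)))) ⟩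
    look sink (forest (suc m) o) (length (table β t o 0) + (i * s + j))
      ≡⟨ look-++ʳ sink (table β t o 0) _ (i * s + j) ⟩
    look sink (forest m (o + s)) (i * s + j)
      ≡⟨ forest-look m (o + s) i j i<m j<s ⟩
    look sink (table β t (o + s + i * s) 0) j
      ≡⟨ cong (λ o → look sink (table β t o 0) j) (+-assoc o s (i * s)) ⟩
    look sink (table β t (o + (s + i * s)) 0) j ∎
    where open ≡-Reasoning

  node : ℕ → Node
  node = look sink (forest σ 0)

  open Layered node β D public

  node-sink : ∀ {v} → β ≤ v → node v ≡ sink
  node-sink β≤v = look-beyond sink (forest σ 0) (≤-trans (≤-reflexive (forest-length σ 0)) β≤v)

  sink-level : SinkLevel
  sink-level β≤v = cong proj₁ (node-sink β≤v)

  rooted : ∀ {i} → i < σ → Rooted t (i * s) 0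
  rooted {i} i<σ = table-rooted node β D sink t (i * s) 0 λ j j<s → forest-look σ 0 i j i<σ j<s

  root-bound : ∀ {i} → i < σ → i * s + s ≤ β
  root-bound {i} i<σ = ≤-trans (≤-reflexive (+-comm (i * s) s)) (*-monoˡ-≤ s i<σ)

  climbs : Climbing
  climbs {u} {v} e with u <? β
  ... | no u≮β with () ← trans (sym e) (cong (λ x → proj₂ x v) (node-sink (≮⇒≥ u≮β)))
  ... | yes u<β = subst (λ w → w < v × level v ≡ suc (level w)) (sym u≡)
      (rooted-edge sink-level t (rooted q<σ) refl (root-bound q<σ) (u % s) (m%n<n u s) (subst (λ w → edge w v ≡ true) u≡ e))
    where
    instance
      s≢0 : NonZero s
      s≢0 = >-nonZero (nodes>0 t)
    -- All trees have `s` nodes, so the quotient names the tree that contains `u` and the remainder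
    -- the place in it.
    q<σ : u / s < σ
    q<σ = m<n*o⇒m/o<n u<β
    u≡ : u ≡ u / s * s + u % s
    u≡ = trans (m≡m%n+[m/n]*n u s) (+-comm (u % s) _)

  leafPositions : ℕ → ℕ → List ℕ
  leafPositions zero    o = []
  leafPositions (suc m) o = positions t o ++ leafPositions m (o + s)

  leafPositions-length : ∀ m o → length (leafPositions m o) ≡ m * leaves t
  leafPositions-length zero    o = refl
  leafPositions-length (suc m) o = trans (length-++ (positions t o))
    (cong₂ _+_ (positions-length t o) (leafPositions-length m (o + s)))

  leafPositions-within : ∀ m o → All (Within o (o + m * s)) (leafPositions m o)
  leafPositions-within zero    o = []
  leafPositions-within (suc m) o = All.++⁺
    (widen ≤-refl (+-monoʳ-≤ o (m≤m+n s (m * s))) (positions-within t o))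
    (widen (m≤m+n o s) (≤-reflexive (+-assoc o s (m * s))) (leafPositions-within m (o + s)))

  leafPositions-Unique : ∀ m o → Unique (leafPositions m o)
  leafPositions-Unique zero    o = []
  leafPositions-Unique (suc m) o = Unique.++⁺ (positions-Unique t o) (leafPositions-Unique m (o + s))
    (within-disjoint (positions-within t o) (leafPositions-within m (o + s)))

  ∈-leafPositions : ∀ m {o p} → p ∈ leafPositions m o → Σ ℕ λ i → i < m × Σ (Leaf t) λ ℓ → pos ℓ (o + i * s) ≡ p
  ∈-leafPositions (suc m) {o} p∈ with ∈-++⁻ (positions t o) p∈
  ... | inj₁ h = let ℓ , e = ∈-positions t h in 0 , z<s , ℓ , trans (cong (pos ℓ) (+-identityʳ o)) e
  ... | inj₂ h = let i , i<m , ℓ , e = ∈-leafPositions m h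
                 in suc i , s≤s i<m , ℓ , trans (cong (pos ℓ) (sym (+-assoc o s (i * s)))) e

  module _ (k : Kind) (n : ℕ) (β≤n : β ≤ n) where

    open Network node β D climbs sink-level k n public

    private
      rootsℕ sinksℕ : List ℕ
      rootsℕ = map (_* s) (upTo σ)
      sinksℕ = map (β +_) (upTo (n ∸ β))

      roots<n : All (_< n) rootsℕ
      roots<n = All.map⁺ (All.tabulate λ i∈ → <-≤-trans (m<m+n _ (nodes>0 t)) (≤-trans (root-bound (∈-upTo⁻ i∈)) β≤n))

      sinks<n : All (_< n) sinksℕ
      sinks<n = All.map⁺ (All.tabulate λ i∈ → <-≤-trans (+-monoʳ-< β (∈-upTo⁻ i∈)) (≤-reflexive (m+[n∸m]≡n β≤n)))

      leaves<n : All (_< n) (leafPositions σ 0)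
      leaves<n = All.map (λ (_ , p<β) → <-≤-trans p<β β≤n) (leafPositions-within σ 0)

      from-Unique : ∀ {xs} {ys : List (Fin n)} → map toℕ ys ≡ xs → Unique xs → Unique ys
      from-Unique refl u = Unique.map⁻ u

      roots = fromℕs rootsℕ roots<n
      sinks = fromℕs sinksℕ sinks<n
      tips  = fromℕs (leafPositions σ 0) leaves<n

    sources : List (Fin n)
    sources = proj₁ roots

    sources-Unique : Unique sources
    sources-Unique = from-Unique (proj₂ roots)
      (Unique.map⁺ (λ {i} {j} → *-cancelʳ-≡ i j s {{>-nonZero (nodes>0 t)}}) (Unique.upTo⁺ σ))

    sources-length : length sources ≡ σ
    sources-length = trans (sym (length-map toℕ sources))
      (trans (cong length (proj₂ roots)) (trans (length-map (_* s) (upTo σ)) (length-upTo σ)))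

    source : ∀ {i} → i < σ → Σ (Fin n) λ r → r ∈ sources × toℕ r ≡ i * s
    source {i} i<σ with ∈-map⁻ toℕ (subst (i * s ∈_) (sym (proj₂ roots)) (∈-map⁺ (_* s) (∈-upTo⁺ i<σ)))
    ... | r , r∈ , e = r , r∈ , sym e

    leafEdges : List (Fin n × Fin n)
    leafEdges = cartesianProduct (proj₁ tips) (proj₁ sinks)

    leafEdges-Unique : Unique leafEdges
    leafEdges-Unique = Unique.cartesianProduct⁺ (from-Unique (proj₂ tips) (leafPositions-Unique σ 0))
      (from-Unique (proj₂ sinks) (Unique.map⁺ (+-cancelˡ-≡ β _ _) (Unique.upTo⁺ (n ∸ β))))

    leafEdges-length : length leafEdges ≡ σ * leaves t * (n ∸ β)
    leafEdges-length = trans (length-cartesianProduct (proj₁ tips) (proj₁ sinks)) (cong₂ _*_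
      (trans (sym (length-map toℕ (proj₁ tips))) (trans (cong length (proj₂ tips)) (leafPositions-length σ 0)))
      (trans (sym (length-map toℕ (proj₁ sinks))) (trans (cong length (proj₂ sinks))
        (trans (length-map (β +_) (upTo (n ∸ β))) (length-upTo (n ∸ β))))))

    canon-< : ∀ k {u v : Fin n} → toℕ u < toℕ v → canon k u v ≡ true
    canon-< directed   _   = refl
    canon-< undirected {u} {v} u<v with toℕ u <ᵇ toℕ v | <⇒<ᵇ u<v
    ... | true | _ = refl

    -- Each pair `(z , x)` has its own witness: the root above `z`, the target `x`, and the cuts of
    -- the leaf `z`. The pair is canonical because `z` lies below `β` and `x` does not.
    leafEdges-overlay : ∀ {f} → CutBound f t →
      All (λ e → canon k (proj₁ e) (proj₂ e) ≡ true × InOverlay network (scheme network) f sources e) leafEdges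
    leafEdges-overlay {f} bound = All.tabulate λ {(z , x)} e∈ →
      let z∈ , x∈ = ∈-cartesianProduct⁻ (proj₁ tips) (proj₁ sinks) e∈ in
      selects z x (subst (toℕ z ∈_) (proj₂ tips) (∈-map⁺ toℕ z∈)) (is-sink (subst (toℕ x ∈_) (proj₂ sinks) (∈-map⁺ toℕ x∈)))
      where
      is-sink : ∀ {x} → x ∈ sinksℕ → β ≤ x
      is-sink x∈ with _ , _ , refl ← ∈-map⁻ (β +_) x∈ = m≤m+n β _
      selects : ∀ z x → toℕ z ∈ leafPositions σ 0 → β ≤ toℕ x →
        canon k z x ≡ true × InOverlay network (scheme network) f sources (z , x)
      selects z x z∈ β≤x with ∈-leafPositions σ z∈
      ... | i , i<σ , ℓ , pos≡z with source i<σ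
      ...   | r , r∈ , r≡ with leaf-edge-selected ℓ r≡ (rooted i<σ)
               (cuts-fit node β D (cuts ℓ (i * s)) ℓ (i * s) (λ _ h → h) (λ h → h))
               refl (root-bound i<σ)
        where
        open Faulty (isCut (cuts ℓ (i * s))) (λ u v c → cuts-edge node β D ℓ (rooted i<σ) (isCut⁻ c)) x β≤x
      ...     | w , w≡ , on with refl ← toℕ-injective {i = w} {j = z} (trans w≡ pos≡z) =
        canon-< k (<-≤-trans (proj₂ (All.lookup (leafPositions-within σ 0) z∈)) β≤x) ,
        r , r∈ , x , F , faults-valid ,
        ≤-trans (size-isCut k n (cuts ℓ (i * s)) (λ c → proj₁ (climbs (cuts-edge node β D ℓ (rooted i<σ) c)))) (bound ℓ (i * s)) ,
        on
        where
        open Faulty (isCut (cuts ℓ (i * s))) (λ u v c → cuts-edge node β D ℓ (rooted i<σ) (isCut⁻ c)) x β≤x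

ratio>0 : ∀ f → 1 ≤ ratio f
ratio>0 zero    = ≤-refl
ratio>0 (suc f) = s≤s z≤n

-- The asymptotic bound raised to the power `2 ^ f`, which clears the roots; `d` depends on `f`
-- only. The distinct canonical pairs in `L` bound the number of edges of the overlay from below.
theorem19 : ∀ (f : ℕ) → Σ ℕ λ d → ∀ (σ : ℕ) → Σ ℕ λ N → ∀ (n : ℕ) → N ≤ n → ∀ (k : Kind) →
    Σ (Graph k n) λ G → Σ (List (Fin n)) λ S → Unique S × length S ≡ σ ×
    Σ (Scheme n) λ π → IsRPTS G π × Consistent G π × Stable G π × (k ≡ undirected → Symmetric G π) ×
    Σ (List (Fin n × Fin n)) λ L → Unique L ×
    All (λ e → canon k (proj₁ e) (proj₂ e) ≡ true × InOverlay G π f S e) L ×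
    n ^ (2 ^ suc f ∸ 1) * σ ≤ (d * length L) ^ (2 ^ f)
-- The 2 in `2 * A` stems from `n ≤ 2 * (n ∸ β)`, and `2 * (σ * c)` vertices are what the choice
-- `b = 1` asks for.
theorem19 f = 2 * A , λ σ → 2 * (σ * c) , λ n N≤n k →
  let b , 1≤b , small , n≤ = fit p c σ (ratio>0 f) N≤n
      open Forest (tree f b) σ
      2β≤n : 2 * β ≤ n
      2β≤n = ≤-trans (*-monoʳ-≤ 2 (*-monoʳ-≤ σ (≤-trans (tree-size f b 1≤b) (≤-reflexive (cong (λ e → c * b ^ e) 2^f≡))))) small
      β≤n = ≤-trans (m≤m+n β _) 2β≤n
      G = network k n β≤n
  in G , sources k n β≤n , sources-Unique k n β≤n , sources-length k n β≤n ,
     scheme G , scheme-isRPTS G , scheme-consistent G , scheme-stable G , scheme-symmetric G ,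
     leafEdges k n β≤n , leafEdges-Unique k n β≤n , leafEdges-overlay k n β≤n (tree-cutBound f b) ,
     subst₂ (λ e P → n ^ e * σ ≤ (2 * A * length (leafEdges k n β≤n)) ^ P) (sym exponent≡) (sym 2^f≡)
       (≤-trans (power-bound p σ A b n A>0 n≤) (^-monoˡ-≤ (suc p)
         (subst (λ l → n * (σ * A * b ^ p) ≤ 2 * A * l) (sym (leafEdges-length k n β≤n))
           (count σ b n (leaves (tree f b)) β 2β≤n (tree-leaves f b)))))
  where
  c = ratio f
  p = 2 ^ f ∸ 1
  A = factor p c
  2^f≡ : 2 ^ f ≡ suc p
  2^f≡ = sym (m+[n∸m]≡n (m^n>0 2 f))
  A>0 : 1 ≤ A
  A>0 = *-mono-≤ {1} {2 * c} {1} (*-mono-≤ {1} {2} (s≤s z≤n) (ratio>0 f)) (m^n>0 2 (suc p))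
  exponent≡ : 2 ^ suc f ∸ 1 ≡ suc p + p
  exponent≡ = trans (cong (λ e → e + (e + 0) ∸ 1) 2^f≡) (trans (cong (p +_) (+-identityʳ (suc p))) (+-suc p p))
  count : ∀ σ b n K β → 2 * β ≤ n → b ^ p ≤ K → n * (σ * A * b ^ p) ≤ 2 * A * (σ * K * (n ∸ β))
  count σ b n K β 2β≤n b^p≤K = begin
    n * (σ * A * b ^ p)                ≤⟨ *-mono-≤ half (*-monoʳ-≤ (σ * A) b^p≤K) ⟩
    2 * (n ∸ β) * (σ * A * K)
      ≡⟨ solve 4 (λ m s a k → con 2 :* m :* (s :* a :* k) := con 2 :* a :* (s :* k :* m)) refl (n ∸ β) σ A K ⟩
    2 * A * (σ * K * (n ∸ β))          ∎
    where
    open ≤-Reasoning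
    half : n ≤ 2 * (n ∸ β)
    half = begin
      n                  ≡⟨ sym (m+n∸n≡m n n) ⟩
      n + n ∸ n          ≤⟨ ∸-monoʳ-≤ (n + n) 2β≤n ⟩
      n + n ∸ 2 * β      ≡⟨ cong (λ x → n + x ∸ 2 * β) (sym (+-identityʳ n)) ⟩
      2 * n ∸ 2 * β      ≡⟨ sym (*-distribˡ-∸ 2 n β) ⟩
      2 * (n ∸ β)        ∎
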